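{- For all integers $n \geq 0$, $k \geq 1$, $a \geq 1$, and arbitrary real $q$, $l_1, \ldots, l_k$, $x$, $y$ (with $l_1, \ldots, l_k \neq 0$), writing $L=(l_1,\ldots,l_k)$, $$c^{(k)}_{n,a,q,L,y}(x) = (-1)^{a-1} \sum_{m=0}^n (-1)^n \genfrac{[}{]}{0pt}{}{n}{m}_{(y,q)}\mathbb{C}_{m+a-1}^{(k)}(x;L)$$ and $$\widehat{c}^{(k)}_{n,a,q,L,y}(x) = (-1)^{a-1} \sum_{m=0}^n (-1)^{n-m} \genfrac{[}{]}{0pt}{}{n}{m}_{(-y,q)}\mathbb{C}_{m+a-1}^{(k)}(x;L).$$
   Context: The multiparameter poly-Cauchy polynomials of the first and second kind are $$c^{(k)}_{n,a,q,L,y}(x) = \int_0^{l_1}\!\! \cdots \int_0^{l_k} (t_1 \cdots t_k -x)^{a-1}\prod_{j=0}^{n-1}(t_1 \cdots t_k -x -y -j q)\, dt_1 \cdots dt_k,$$ $$\widehat{c}^{(k)}_{n,a,q,L,y}(x) = (-1)^{a-1} \int_0^{l_1}\!\! \cdots \int_0^{l_k} (x - t_1 \cdots t_k)^{a-1}\prod_{j=0}^{n-1}(x +y - t_1 \cdots t_k -j q)\, dt_1 \cdots dt_k,$$ where $t_i$ is integrated from $0$ to $l_i$. The (bivariate) Stirling polynomials of the first kind are $$\genfrac{[}{]}{0pt}{}{n}{m}_{(y,q)} = \sum_{i=0}^{n-m} \binom{i+m}{m}\genfrac{[}{]}{0pt}{}{n}{i+m}y^i q^{n-m-i}, \quad 0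 \leq m \leq n,$$ where $\genfrac{[}{]}{0pt}{}{n}{m}$ are the unsigned Stirling numbers of the first kind. The augmented polynomials are $\mathbb{C}_0^{(k)}(x;L)=l_1\cdots l_k$ and $$\mathbb{C}_j^{(k)}(x;L) = \sum_{i=0}^{j} \frac{(-1)^i}{(i+1)^k} (l_1 \cdots l_k )^{i+1} \binom{j}{i} x^{j-i},\quad j\ge1.$$ Zeroth powers are equal to $1$. -}

module Defs where

open import Level using (Level; Lift; _⊔_) renaming (suc to lsuc)
open import Algebra.Apartness.Bundles using (HeytingField)
open import Algebra.Bundles using (CommutativeRing; Semiring)
import Algebra.Definitions.RawSemiring as RawSemiringDefs
import Algebra.Properties.Monoid.Sum as MonoidSum
open import Data.Fin.Base using (Fin; zero; suc; toℕ; fromℕ; inject₁)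
open import Data.Nat.Base as ℕ using (ℕ; zero; suc; NonZero; _∸_)
import Data.Nat.Properties as ℕ
open import Data.Nat.Combinatorics using (_C_)
open import Data.Product.Base using (_×_; _,_; ∃-syntax; proj₁; proj₂)
open import Data.Sum.Base using (_⊎_; inj₂)
open import Data.Vec.Functional using (Vector; []; _∷_; head; tail)
open import Function.Bundles using (_⇔_; module Equivalence)
open import Relation.Binary.Core using (Rel)
open import Relation.Binary.Structures using (IsStrictPartialOrder)
open import Relation.Nullary.Negation using (¬_)

-- The real numbers, axiomatised as an Archimedean, Cauchy-complete ordered
-- field.  Classically this determines ℝ up to unique isomorphism; the axioms
-- are phrased with a strict order and an apartness (as usual in constructive
-- analysis), so that no decidability of the order is presupposed.
record RealField c ℓ₁ ℓ₂ : Set (lsuc (c ⊔ ℓ₁ ⊔ ℓ₂)) where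
  infix 4 _<_ _≤_

  field
    heytingField : HeytingField c ℓ₁ ℓ₂

  open HeytingField heytingField public hiding (zero)

  commutativeRing : CommutativeRing c ℓ₁
  commutativeRing = record { isCommutativeRing = isCommutativeRing }

  open RawSemiringDefs (Semiring.rawSemiring (CommutativeRing.semiring commutativeRing)) public
    using (_^_; product) renaming (_×_ to _·_)

  open MonoidSum (CommutativeRing.+-monoid commutativeRing) public
    using (sum; sum-syntax; sum⁺-syntax)

  field
    _<_                  : Rel Carrier ℓ₂
    isStrictPartialOrder : IsStrictPartialOrder _≈_ _<_
    #⇔<⊎>                : ∀ {x y} → x # y ⇔ (x < y ⊎ y < x)
    0<1                  : 0# < 1#
    +-monoˡ-<            : ∀ z {x y} → x < y → x + z < y + z
    *-pos                : ∀ {x y} → 0# < x → 0# < y → 0# < x * y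

  module < = IsStrictPartialOrder isStrictPartialOrder

  _≤_ : Rel Carrier ℓ₂
  x ≤ y = ¬ (y < x)

  -- ∣ x - y ∣ < ε
  Near : Carrier → Carrier → Carrier → Set ℓ₂
  Near ε x y = x - y < ε × y - x < ε

  IsCauchy : (ℕ → Carrier) → Set (c ⊔ ℓ₂)
  IsCauchy s = ∀ ε → 0# < ε → ∃[ N ] ∀ m n → N ℕ.≤ m → N ℕ.≤ n → Near ε (s m) (s n)

  ConvergesTo : (ℕ → Carrier) → Carrier → Set (c ⊔ ℓ₂)
  ConvergesTo s x = ∀ ε → 0# < ε → ∃[ N ] ∀ n → N ℕ.≤ n → Near ε (s n) x

  field
    archimedean : ∀ x → ∃[ n ] x < n · 1#
    complete    : ∀ s → IsCauchy s → ∃[ x ] ConvergesTo s x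

-- Unsigned Stirling numbers of the first kind.
stirling₁ : ℕ → ℕ → ℕ
stirling₁ zero    zero    = 1
stirling₁ zero    (suc m) = 0
stirling₁ (suc n) zero    = 0
stirling₁ (suc n) (suc m) = n ℕ.* stirling₁ n (suc m) ℕ.+ stirling₁ n m

module Reciprocals {c ℓ₁ ℓ₂ : Level} (ℝ : RealField c ℓ₁ ℓ₂) where
  open RealField ℝ

  0<suc : ∀ n → 0# < suc n · 1#
  0<suc zero    = <.<-respʳ-≈ (sym (+-identityʳ 1#)) 0<1
  0<suc (suc n) = <.trans (0<suc n)
    (<.<-respˡ-≈ (+-identityˡ _) (+-monoˡ-< (suc n · 1#) 0<1))

  suc#0 : ∀ n → suc n · 1# # 0#
  suc#0 n = Equivalence.from #⇔<⊎> (inj₂ (0<suc n))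

  -- #⇒invertible literally inverts n - 0.
  1/_ : (n : ℕ) .{{_ : NonZero n}} → Carrier
  1/ (suc n) = proj₁ (#⇒invertible (suc#0 n))

module Integration {c ℓ₁ ℓ₂ : Level} (ℝ : RealField c ℓ₁ ℓ₂) where
  open RealField ℝ

  record TaggedPartition (a b : Carrier) : Set (c ⊔ ℓ₁ ⊔ ℓ₂) where
    field
      size      : ℕ
      point     : Fin (suc size) → Carrier
      tag       : Fin size → Carrier
      start     : point zero ≈ a
      end       : point (fromℕ size) ≈ b
      point≤tag : ∀ i → point (inject₁ i) ≤ tag i
      tag≤point : ∀ i → tag i ≤ point (suc i)

    width : Fin size → Carrier
    width i = point (suc i) - point (inject₁ i)

    FinerThan : Carrier → Set ℓ₂
    FinerThan δ = ∀ i → width i < δ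

    riemannSum : (Carrier → Carrier) → Carrier
    riemannSum f = ∑[ i < size ] (f (tag i) * width i)

  -- For a ≤ b: f is Riemann integrable on [a, b], with integral I.
  IsRiemannIntegral : (a b : Carrier) → (Carrier → Carrier) → Carrier → Set (c ⊔ ℓ₁ ⊔ ℓ₂)
  IsRiemannIntegral a b f I =
    ∀ ε → 0# < ε → ∃[ δ ] 0# < δ ×
      (∀ (P : TaggedPartition a b) → TaggedPartition.FinerThan P δ →
        Near ε (TaggedPartition.riemannSum P f) I)

  -- I = ∫ₐᵇ f, where ∫ₐᵇ f = - ∫ᵇₐ f when b ≤ a.
  IsIntegral : (a b : Carrier) → (Carrier → Carrier) → Carrier → Set (c ⊔ ℓ₁ ⊔ ℓ₂)
  IsIntegral a b f I =
    (a ≤ b × IsRiemannIntegral a b f I) ⊎ (b ≤ a × IsRiemannIntegral b a f (- I))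

  Between : (a b t : Carrier) → Set ℓ₂
  Between a b t = (a ≤ t × t ≤ b) ⊎ (b ≤ t × t ≤ a)

  -- I = ∫₀^{l₁} ⋯ ∫₀^{lₖ} F (t₁ , … , tₖ), with the t₁-integral outermost;
  -- g t₁ is the value of the integral over t₂, …, tₖ.
  IsIteratedIntegral : ∀ {k} → Vector Carrier k → (Vector Carrier k → Carrier) →
                       Carrier → Set (c ⊔ ℓ₁ ⊔ ℓ₂)
  IsIteratedIntegral {zero}  L F I = Lift (c ⊔ ℓ₂) (I ≈ F [])
  IsIteratedIntegral {suc k} L F I = ∃[ g ]
    (∀ t → Between 0# (head L) t →
      IsIteratedIntegral (tail L) (λ ts → F (t ∷ ts)) (g t)) ×
    IsIntegral 0# (head L) g I

module PolyCauchy {c ℓ₁ ℓ₂ : Level} (ℝ : RealField c ℓ₁ ℓ₂) where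
  open RealField ℝ
  open Reciprocals ℝ
  open Integration ℝ

  -- The value v of c^(k)_{n,a,q,L,y}(x), for a ≥ 1.
  IsPolyCauchy₁ : ∀ {k} (n a : ℕ) (q : Carrier) (L : Vector Carrier k) (y x : Carrier) →
                  Carrier → Set (c ⊔ ℓ₁ ⊔ ℓ₂)
  IsPolyCauchy₁ n a q L y x v = IsIteratedIntegral L
    (λ t → (product t - x) ^ (a ∸ 1) *
           product {n} (λ j → product t - x - y - toℕ j · q))
    v

  -- The value v of ĉ^(k)_{n,a,q,L,y}(x), for a ≥ 1.
  IsPolyCauchy₂ : ∀ {k} (n a : ℕ) (q : Carrier) (L : Vector Carrier k) (y x : Carrier) →
                  Carrier → Set (c ⊔ ℓ₁ ⊔ ℓ₂)
  IsPolyCauchy₂ n a q L y x v = ∃[ I ]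
    IsIteratedIntegral L
      (λ t → (x - product t) ^ (a ∸ 1) *
             product {n} (λ j → x + y - product t - toℕ j · q))
      I ×
    v ≈ (- 1#) ^ (a ∸ 1) * I

  -- Only meaningful for m ≤ n.
  stirlingPoly : (n m : ℕ) (y q : Carrier) → Carrier
  stirlingPoly n m y q =
    ∑[ i ≤ n ∸ m ] ((((toℕ i ℕ.+ m) C m) ℕ.* stirling₁ n (toℕ i ℕ.+ m)) ·
      (y ^ toℕ i * q ^ (n ∸ m ∸ toℕ i)))

  augmented : ∀ {k} → ℕ → Carrier → Vector Carrier k → Carrier
  augmented     zero      x L = product L
  augmented {k} j@(suc _) x L =
    ∑[ i ≤ j ] ((- 1#) ^ toℕ i * (1/ (suc (toℕ i) ℕ.^ k)) {{ℕ.m^n≢0 (suc (toℕ i)) k}} *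
                product L ^ suc (toℕ i) * ((j C toℕ i) · x ^ (j ∸ toℕ i)))

{-# OPTIONS --safe #-}

-- Put u = x - t₁⋯tₖ.  The generating function
--   Σₘ [n m]_{(y,q)} uᵐ = Π_{j<n} (u + y + j q),
-- a binomial expansion of Σₚ [n p] zᵖ qⁿ⁻ᵖ = Π_{j<n} (z + j q) at z = u + y,
-- turns both integrands into linear combinations of powers u^{m+a-1}; integrating
-- (x - t₁⋯tₖ)ʲ monomial by monomial gives ℂⱼ.  The integrals themselves are
-- evaluated by comparing Riemann sums with telescoping sums of an antiderivative F:
-- since F v - F t - F′ t (v - t) = O((v - t)²) uniformly on bounded sets, a partition
-- of mesh δ has error O(δ).

module Submission where

open import Level using (_⊔_; lift)
open import Algebra.Bundles using (CommutativeRing)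
import Algebra.Apartness.Properties.HeytingCommutativeRing as HeytingProperties
import Algebra.Properties.AbelianGroup as AbelianGroupProperties
import Algebra.Properties.CommutativeSemiring.Binomial as Binomial
import Algebra.Properties.CommutativeSemiring.Exp as Exp
import Algebra.Properties.Monoid.Sum as MonoidSum
import Algebra.Properties.Ring as RingProperties
import Algebra.Properties.Semiring.Mult as SemiringMult
import Algebra.Properties.Semiring.Sum as SemiringSum
import Algebra.Solver.Ring as RingSolver
open import Algebra.Solver.Ring.AlmostCommutativeRing using (_-Raw-AlmostCommutative⟶_; fromCommutativeRing)
open import Data.Fin.Base using (Fin; zero; suc; toℕ; fromℕ; inject₁)
import Data.Fin.Properties as Fin
open import Data.Integer.Base as ℤ using (ℤ; +_; -[1+_]; _⊖_; _◃_; sign; ∣_∣)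
import Data.Integer.Properties as ℤ
open import Data.Maybe.Base using (Maybe; map)
open import Data.Nat.Base as ℕ using (ℕ; zero; suc; NonZero; _∸_)
open import Data.Nat.Combinatorics using (_C_)
import Data.Nat.Properties as ℕ
open import Data.Product.Base using (_×_; _,_; ∃-syntax; proj₁; proj₂)
open import Data.Sign.Base as Sign using (Sign)
open import Data.Sum.Base using (_⊎_; inj₁; inj₂; [_,_]′)
open import Data.Vec.Functional using (Vector; []; _∷_; head; tail)
open import Defs
open import Function.Base using (_∘_)
open import Function.Bundles using (module Equivalence)
open import Relation.Binary.PropositionalEquality.Core as ≡ using (_≡_)
import Relation.Binary.Reasoning.Setoid as ≈-Reasoning
open import Relation.Nullary.Decidable.Core using (dec⇒maybe)
open import Relation.Nullary.Negation using (contradiction)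

-- The order is undecidable and `≤` is only the negation of a converse `<`, so no step may compare
-- two reals outright: bounds on magnitudes are pairs of inequalities, and case distinctions come
-- from apartness. In particular `L i # 0#` decides the sign of each limit and hence the orientation
-- of each integral. An integral has to be exhibited with an explicit mesh for every ε, so
-- smoothness is carried as constants, built up by induction on the exponent. The iteration over t₁,
-- ..., tₖ stays within polynomials in a single product: for fixed t₁ the power (t₁⋯tₖ)ʲ is
-- t₁ʲ(t₂⋯tₖ)ʲ, so t₁ʲ can be absorbed into the coefficients, and the inner integral is again a
-- polynomial in t₁.

-- With coefficients in ℤ, whose equality is decidable, the ring solver can cancel x - x.
module IntegerCoefficients {c ℓ} (R : CommutativeRing c ℓ) where
  open CommutativeRing R
  open AbelianGroupProperties +-abelianGroup
    using (⁻¹-∙-comm; xyx⁻¹≈y; ⁻¹-involutive; ε⁻¹≈ε)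
  open RingProperties ring using (-‿distribˡ-*; -‿distribʳ-*)
  open SemiringMult semiring using (×-homo-+; ×1-homo-*; ×-homo-1) renaming (_×_ to _·_)
  open ≈-Reasoning setoid

  fromℤ : ℤ → Carrier
  fromℤ (+ n)    = n · 1#
  fromℤ -[1+ n ] = - (suc n · 1#)

  private
    signed : Sign → Carrier → Carrier
    signed Sign.+ x = x
    signed Sign.- x = - x

    signed-* : ∀ s t x y → signed (s Sign.* t) (x * y) ≈ signed s x * signed t y
    signed-* Sign.+ Sign.+ x y = refl
    signed-* Sign.+ Sign.- x y = -‿distribʳ-* x y
    signed-* Sign.- Sign.+ x y = -‿distribˡ-* x y
    signed-* Sign.- Sign.- x y = begin
      x * y         ≈⟨ ⁻¹-involutive _ ⟨
      - - (x * y)   ≈⟨ -‿cong (-‿distribˡ-* x y) ⟩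
      - (- x * y)   ≈⟨ -‿distribʳ-* (- x) y ⟩
      - x * - y     ∎

    signed-cong : ∀ s {x y} → x ≈ y → signed s x ≈ signed s y
    signed-cong Sign.+ x≈y = x≈y
    signed-cong Sign.- x≈y = -‿cong x≈y

  fromℤ-⊖ : ∀ m n → fromℤ (m ⊖ n) ≈ m · 1# - n · 1#
  fromℤ-⊖ zero    zero    = sym (-‿inverseʳ 0#)
  fromℤ-⊖ zero    (suc n) = sym (+-identityˡ _)
  fromℤ-⊖ (suc m) zero    = sym (trans (+-congˡ ε⁻¹≈ε) (+-identityʳ _))
  fromℤ-⊖ (suc m) (suc n) = begin
    fromℤ (suc m ⊖ suc n)                        ≡⟨ ≡.cong fromℤ (ℤ.[1+m]⊖[1+n]≡m⊖n m n) ⟩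
    fromℤ (m ⊖ n)                                ≈⟨ fromℤ-⊖ m n ⟩
    m · 1# - n · 1#                              ≈⟨ +-congʳ (xyx⁻¹≈y 1# (m · 1#)) ⟨
    1# + m · 1# - 1# - n · 1#                    ≈⟨ +-assoc _ _ _ ⟩
    1# + m · 1# + (- 1# - n · 1#)                ≈⟨ +-congˡ (⁻¹-∙-comm 1# (n · 1#)) ⟩
    suc m · 1# - suc n · 1#                      ∎

  fromℤ-+ : ∀ i j → fromℤ (i ℤ.+ j) ≈ fromℤ i + fromℤ j
  fromℤ-+ (+ m)    (+ n)    = ×-homo-+ 1# m n
  fromℤ-+ (+ m)    -[1+ n ] = fromℤ-⊖ m (suc n)
  fromℤ-+ -[1+ m ] (+ n)    = trans (fromℤ-⊖ n (suc m)) (+-comm _ _)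
  fromℤ-+ -[1+ m ] -[1+ n ] = begin
    - (suc (suc (m ℕ.+ n)) · 1#)          ≡⟨ ≡.cong (λ k → - (suc k · 1#)) (≡.sym (ℕ.+-suc m n)) ⟩
    - ((suc m ℕ.+ suc n) · 1#)            ≈⟨ -‿cong (×-homo-+ 1# (suc m) (suc n)) ⟩
    - (suc m · 1# + suc n · 1#)           ≈⟨ ⁻¹-∙-comm _ _ ⟨
    - (suc m · 1#) - suc n · 1#           ∎

  fromℤ-neg : ∀ i → fromℤ (ℤ.- i) ≈ - fromℤ i
  fromℤ-neg (+ zero)  = sym ε⁻¹≈ε
  fromℤ-neg (+ suc n) = refl
  fromℤ-neg -[1+ n ]  = sym (⁻¹-involutive _)

  fromℤ-◃ : ∀ s n → fromℤ (s ◃ n) ≈ signed s (n · 1#)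
  fromℤ-◃ Sign.+ zero    = refl
  fromℤ-◃ Sign.+ (suc n) = refl
  fromℤ-◃ Sign.- zero    = sym ε⁻¹≈ε
  fromℤ-◃ Sign.- (suc n) = refl

  fromℤ-signAbs : ∀ i → fromℤ i ≡ signed (sign i) (∣ i ∣ · 1#)
  fromℤ-signAbs (+ n)    = ≡.refl
  fromℤ-signAbs -[1+ n ] = ≡.refl

  fromℤ-* : ∀ i j → fromℤ (i ℤ.* j) ≈ fromℤ i * fromℤ j
  fromℤ-* i j = begin
    fromℤ (s ◃ ∣ i ∣ ℕ.* ∣ j ∣)                                      ≈⟨ fromℤ-◃ s (∣ i ∣ ℕ.* ∣ j ∣) ⟩
    signed s ((∣ i ∣ ℕ.* ∣ j ∣) · 1#)                                ≈⟨ signed-cong s (×1-homo-* ∣ i ∣ ∣ j ∣) ⟩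
    signed s ((∣ i ∣ · 1#) * (∣ j ∣ · 1#))                           ≈⟨ signed-* (sign i) (sign j) _ _ ⟩
    signed (sign i) (∣ i ∣ · 1#) * signed (sign j) (∣ j ∣ · 1#)      ≡⟨ ≡.cong₂ _*_ (fromℤ-signAbs i) (fromℤ-signAbs j) ⟨
    fromℤ i * fromℤ j                                                ∎
    where s = sign i Sign.* sign j

  fromℤ-homomorphism : ℤ.+-*-rawRing -Raw-AlmostCommutative⟶ fromCommutativeRing R
  fromℤ-homomorphism = record
    { ⟦_⟧    = fromℤ
    ; +-homo = fromℤ-+
    ; *-homo = fromℤ-*
    ; -‿homo = fromℤ-neg
    ; 0-homo = refl
    ; 1-homo = ×-homo-1 1#
    }

  fromℤ-≟ : ∀ i j → Maybe (fromℤ i ≈ fromℤ j)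
  fromℤ-≟ i j = map (λ i≡j → reflexive (≡.cong fromℤ i≡j)) (dec⇒maybe (i ℤ.≟ j))

  module Solver = RingSolver ℤ.+-*-rawRing (fromCommutativeRing R) fromℤ-homomorphism fromℤ-≟

stirling₁-zero : ∀ {n m} → n ℕ.< m → stirling₁ n m ≡ 0
stirling₁-zero {zero}  {suc m} _             = ≡.refl
stirling₁-zero {suc n} {suc m} (ℕ.s≤s n<m)
  rewrite stirling₁-zero n<m | stirling₁-zero (ℕ.m<n⇒m<1+n n<m) = ≡.trans (ℕ.+-identityʳ (n ℕ.* 0)) (ℕ.*-zeroʳ n)

module PolyCauchyExpansion {c ℓ₁ ℓ₂} (ℝ : RealField c ℓ₁ ℓ₂) where
  open RealField ℝ
  open CommutativeRing commutativeRing using (semiring; commutativeSemiring; ring; +-abelianGroup; *-monoid)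
  open HeytingProperties heytingCommutativeRing using (x-0≈x; invertibleˡ⇒#)
  open AbelianGroupProperties +-abelianGroup using (⁻¹-involutive; ⁻¹-anti-homo‿-)
  open RingProperties ring using (-1*x≈-x)
  open SemiringMult semiring using (×-congʳ; ×-comm-*; ×-assoc-*; ×-homo-+; ×-assocˡ; ×1-homo-*)
  open SemiringSum semiring
    using (sum-cong-≋; *-distribˡ-sum; *-distribʳ-sum; ∑-distrib-+; sum-init-last; sum-replicate-zero)
  open MonoidSum *-monoid using () renaming (sum-cong-≋ to product-cong; sum-init-last to product-init-last)
  open Exp commutativeSemiring using (^-distrib-*; ^-congˡ; ^-homo-*)
  open IntegerCoefficients commutativeRing using (module Solver)
  open Solver using (solve; _:=_; _:+_; _:*_; _:-_; :-_; con)
  open Reciprocals ℝ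
  open Integration ℝ
  open PolyCauchy ℝ
  open ≈-Reasoning (CommutativeRing.setoid commutativeRing)

  private
    0′ : ∀ {n} → Solver.Polynomial n
    0′ = con ℤ.0ℤ

  -- Consequences of the order axioms

  <⇒# : ∀ {x y} → x < y → x # y
  <⇒# x<y = Equivalence.from #⇔<⊎> (inj₁ x<y)

  -- Cotransitivity of the apartness, with the two wrong orientations repaired by transitivity. It
  -- stands in for deciding the position of `z` relative to `x` and `y`.
  <-cotrans : ∀ {x y} → x < y → ∀ z → x < z ⊎ z < y
  <-cotrans {x} {y} x<y z with #-cotrans (<⇒# x<y) z
  ... | inj₁ x#z with Equivalence.to #⇔<⊎> x#z
  ...   | inj₁ x<z = inj₁ x<z
  ...   | inj₂ z<x = inj₂ (<.trans z<x x<y)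
  <-cotrans {x} {y} x<y z | inj₂ z#y with Equivalence.to #⇔<⊎> z#y
  ...   | inj₁ z<y = inj₂ z<y
  ...   | inj₂ y<z = inj₁ (<.trans x<y y<z)

  ≤-reflexive : ∀ {x y} → x ≈ y → x ≤ y
  ≤-reflexive x≈y = <.irrefl (sym x≈y)

  ≤-refl : ∀ {x} → x ≤ x
  ≤-refl = ≤-reflexive refl

  <⇒≤ : ∀ {x y} → x < y → x ≤ y
  <⇒≤ x<y y<x = <.asym x<y y<x

  ≤-trans : ∀ {x y z} → x ≤ y → y ≤ z → x ≤ z
  ≤-trans {y = y} x≤y y≤z z<x = [ y≤z , x≤y ]′ (<-cotrans z<x y)

  ≤-<-trans : ∀ {x y z} → x ≤ y → y < z → x < z
  ≤-<-trans {x} x≤y y<z with <-cotrans y<z x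
  ... | inj₁ y<x = contradiction y<x x≤y
  ... | inj₂ x<z = x<z

  ≤-resp-≈ : ∀ {x x′ y y′} → x ≈ x′ → y ≈ y′ → x ≤ y → x′ ≤ y′
  ≤-resp-≈ x≈x′ y≈y′ x≤y y′<x′ = x≤y (<.<-respˡ-≈ (sym y≈y′) (<.<-respʳ-≈ (sym x≈x′) y′<x′))

  <-resp-≈ : ∀ {x x′ y y′} → x ≈ x′ → y ≈ y′ → x < y → x′ < y′
  <-resp-≈ x≈x′ y≈y′ x<y = <.<-respˡ-≈ x≈x′ (<.<-respʳ-≈ y≈y′ x<y)

  +-monoˡ-≤ : ∀ z {x y} → x ≤ y → x + z ≤ y + z
  +-monoˡ-≤ z x≤y y+z<x+z = x≤y (<-resp-≈ (cancel _) (cancel _) (+-monoˡ-< (- z) y+z<x+z))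
    where
    cancel : ∀ w → w + z - z ≈ w
    cancel w = solve 2 (λ w z → w :+ z :- z := w) refl w z

  +-mono-≤ : ∀ {x x′ y y′} → x ≤ x′ → y ≤ y′ → x + y ≤ x′ + y′
  +-mono-≤ {x} {x′} {y} {y′} x≤x′ y≤y′ =
    ≤-trans (+-monoˡ-≤ y x≤x′) (≤-resp-≈ (+-comm y x′) (+-comm y′ x′) (+-monoˡ-≤ x′ y≤y′))

  ≤⇒0≤ : ∀ {x y} → x ≤ y → 0# ≤ y - x
  ≤⇒0≤ {x} x≤y = ≤-resp-≈ (-‿inverseʳ x) refl (+-monoˡ-≤ (- x) x≤y)

  0≤⇒≤ : ∀ {x y} → 0# ≤ y - x → x ≤ y
  0≤⇒≤ {x} {y} 0≤y-x = ≤-resp-≈ (+-identityˡ x) (solve 2 (λ x y → y :- x :+ x := y) refl x y) (+-monoˡ-≤ x 0≤y-x)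

  <⇒0< : ∀ {x y} → x < y → 0# < y - x
  <⇒0< {x} x<y = <-resp-≈ (-‿inverseʳ x) refl (+-monoˡ-< (- x) x<y)

  neg-pos : ∀ {x} → x < 0# → 0# < - x
  neg-pos {x} x<0 = <.<-respʳ-≈ (+-identityˡ (- x)) (<⇒0< x<0)

  neg-nonneg : ∀ {x} → x ≤ 0# → 0# ≤ - x
  neg-nonneg {x} x≤0 = ≤-resp-≈ refl (+-identityˡ (- x)) (≤⇒0≤ x≤0)

  neg-antitone : ∀ {x y} → x ≤ y → - y ≤ - x
  neg-antitone {x} {y} x≤y = 0≤⇒≤ (≤-resp-≈ refl (solve 2 (λ x y → y :- x := :- x :- :- y) refl x y) (≤⇒0≤ x≤y))

  0≤-+ : ∀ {x y} → 0# ≤ x → 0# ≤ y → 0# ≤ x + y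
  0≤-+ 0≤x 0≤y = ≤-resp-≈ (+-identityˡ 0#) refl (+-mono-≤ 0≤x 0≤y)

  -- Takes the place of halving: `x < 0#` would give x + x < x < 0.
  0≤x+x⇒0≤x : ∀ {x} → 0# ≤ x + x → 0# ≤ x
  0≤x+x⇒0≤x {x} 0≤x+x x<0 = 0≤x+x (<.trans (<.<-respʳ-≈ (+-identityˡ x) (+-monoˡ-< x x<0)) x<0)

  -- If z inverts xy, then yz inverts x. The subtracted zeros appear because the field axioms invert
  -- `x - 0#` for `x # 0#`.
  #0-*ˡ : ∀ {x y} → x * y # 0# → x # 0#
  #0-*ˡ {x} {y} xy#0 with #⇒invertible xy#0
  ... | z , z[xy-0]≈1 , _ = invertibleˡ⇒# (y * z , trans
    (solve 3 (λ x y z → y :* z :* (x :- 0′) := z :* (x :* y :- 0′)) refl x y z) z[xy-0]≈1)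

  -- The signs of the factors cannot be decided in advance, but the refuted assumption `x * y < 0#`
  -- makes both factors apart from 0, and apartness does decide them.
  0≤-* : ∀ {x y} → 0# ≤ x → 0# ≤ y → 0# ≤ x * y
  0≤-* {x} {y} 0≤x 0≤y xy<0 with Equivalence.to #⇔<⊎> (#0-*ˡ (<⇒# xy<0))
      | Equivalence.to #⇔<⊎> (#0-*ˡ (<⇒# (<.<-respˡ-≈ (*-comm x y) xy<0)))
  ... | inj₁ x<0 | _        = 0≤x x<0
  ... | inj₂ _   | inj₁ y<0 = 0≤y y<0
  ... | inj₂ 0<x | inj₂ 0<y = <.asym xy<0 (*-pos 0<x 0<y)

  *-monoˡ-≤ : ∀ {z x y} → 0# ≤ z → x ≤ y → z * x ≤ z * y
  *-monoˡ-≤ {z} {x} {y} 0≤z x≤y = 0≤⇒≤ (≤-resp-≈ refl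
    (solve 3 (λ x y z → z :* (y :- x) := z :* y :- z :* x) refl x y z)
    (0≤-* 0≤z (≤⇒0≤ x≤y)))

  -- The inverse is itself invertible, so it has a sign; were it negative, x(-y) = -1 would be
  -- positive.
  inverse-pos : ∀ {x} → 0# < x → ∃[ y ] 0# < y × x * y ≈ 1#
  inverse-pos {x} 0<x with #⇒invertible (#-sym (<⇒# 0<x))
  ... | y , y[x-0]≈1 , _ = y , 0<y (Equivalence.to #⇔<⊎> y#0) , xy≈1
    where
    xy≈1 : x * y ≈ 1#
    xy≈1 = trans (solve 2 (λ x y → x :* y := y :* (x :- 0′)) refl x y) y[x-0]≈1
    y#0 : y # 0#
    y#0 = invertibleˡ⇒# (x , trans (*-congˡ (x-0≈x y)) xy≈1)
    0<y : y < 0# ⊎ 0# < y → 0# < y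
    0<y (inj₂ 0<y) = 0<y
    0<y (inj₁ y<0) = contradiction
      (<.trans 0<1 (<-resp-≈ (+-identityˡ 1#) x[-y]+1≈0 (+-monoˡ-< 1# (*-pos 0<x (neg-pos y<0)))))
      (<.irrefl refl)
      where
      x[-y]+1≈0 : x * - y + 1# ≈ 0#
      x[-y]+1≈0 = trans (+-congˡ (sym xy≈1)) (solve 2 (λ x y → x :* :- y :+ x :* y := 0′) refl x y)

  -- Absolute bounds and derivatives with quadratic remainder

  -- ∣ x ∣ ≤ b, stated without an absolute value, which the axioms do not directly provide.
  Bound : Carrier → Carrier → Set ℓ₂
  Bound x b = x ≤ b × - x ≤ b

  Bound-resp-≈ : ∀ {x x′ b b′} → x ≈ x′ → b ≈ b′ → Bound x b → Bound x′ b′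
  Bound-resp-≈ x≈x′ b≈b′ (x≤b , -x≤b) = ≤-resp-≈ x≈x′ b≈b′ x≤b , ≤-resp-≈ (-‿cong x≈x′) b≈b′ -x≤b

  Bound-weaken : ∀ {x b b′} → b ≤ b′ → Bound x b → Bound x b′
  Bound-weaken b≤b′ (x≤b , -x≤b) = ≤-trans x≤b b≤b′ , ≤-trans -x≤b b≤b′

  Bound-neg : ∀ {x b} → Bound x b → Bound (- x) b
  Bound-neg (x≤b , -x≤b) = -x≤b , ≤-resp-≈ (sym (⁻¹-involutive _)) refl x≤b

  Bound-sym : ∀ {x y b} → Bound (x - y) b → Bound (y - x) b
  Bound-sym {x} {y} h = Bound-resp-≈ (⁻¹-anti-homo‿- x y) refl (Bound-neg h)

  Bound-+ : ∀ {x y b d} → Bound x b → Bound y d → Bound (x + y) (b + d)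
  Bound-+ {x} {y} (x≤b , -x≤b) (y≤d , -y≤d) = +-mono-≤ x≤b y≤d ,
    ≤-resp-≈ (solve 2 (λ x y → :- x :- y := :- (x :+ y)) refl x y) refl (+-mono-≤ -x≤b -y≤d)

  Bound⇒0≤ : ∀ {x b} → Bound x b → 0# ≤ b
  Bound⇒0≤ {x} (x≤b , -x≤b) = 0≤x+x⇒0≤x (≤-resp-≈ (-‿inverseʳ x) refl (+-mono-≤ x≤b -x≤b))

  -- Avoids splitting on signs: (b - x)(d + y) + (b + x)(d - y) = 2(bd - xy), and all four factors
  -- on the left are nonnegative.
  *-≤-* : ∀ {x y b d} → Bound x b → Bound y d → x * y ≤ b * d
  *-≤-* {x} {y} {b} {d} (x≤b , -x≤b) (y≤d , -y≤d) = 0≤⇒≤ (0≤x+x⇒0≤x (≤-resp-≈ refl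
    (solve 4 (λ x y b d → (b :- x) :* (d :- :- y) :+ (b :- :- x) :* (d :- y)
      := b :* d :- x :* y :+ (b :* d :- x :* y)) refl x y b d)
    (0≤-+ (0≤-* (≤⇒0≤ x≤b) (≤⇒0≤ -y≤d)) (0≤-* (≤⇒0≤ -x≤b) (≤⇒0≤ y≤d)))))

  Bound-* : ∀ {x y b d} → Bound x b → Bound y d → Bound (x * y) (b * d)
  Bound-* {x} {y} hx hy = *-≤-* hx hy ,
    ≤-resp-≈ (solve 2 (λ x y → :- x :* y := :- (x :* y)) refl x y) refl (*-≤-* (Bound-neg hx) hy)

  0≤⇒Bound : ∀ {x b} → 0# ≤ x → x ≤ b → Bound x b
  0≤⇒Bound {x} 0≤x x≤b = x≤b ,
    ≤-trans (≤-resp-≈ (+-identityˡ (- x)) (-‿inverseʳ x) (+-monoˡ-≤ (- x) 0≤x)) (≤-trans 0≤x x≤b)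

  Bound-0 : Bound 0# 0#
  Bound-0 = 0≤⇒Bound ≤-refl ≤-refl

  0≤n·1 : ∀ n → 0# ≤ n · 1#
  0≤n·1 zero    = ≤-refl
  0≤n·1 (suc n) = <⇒≤ (0<suc n)

  -- The sum of the Archimedean bounds for `x` and `- x` serves as their maximum, both being
  -- nonnegative.
  bounded : ∀ x → ∃[ b ] Bound x b
  bounded x with archimedean x | archimedean (- x)
  ... | m , x<m | n , -x<n = m · 1# + n · 1# ,
    ≤-resp-≈ (+-identityʳ x) refl (+-mono-≤ (<⇒≤ x<m) (0≤n·1 n)) ,
    ≤-resp-≈ (+-identityˡ (- x)) refl (+-mono-≤ (0≤n·1 m) (<⇒≤ -x<n))

  Bound-^ : ∀ {x b} n → Bound x b → Bound (x ^ n) (b ^ n)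
  Bound-^ zero    h = 0≤⇒Bound (<⇒≤ 0<1) ≤-refl
  Bound-^ (suc n) h = Bound-* h (Bound-^ n h)

  Bound⇒Near : ∀ {ε x y b} → Bound (x - y) b → b < ε → Near ε x y
  Bound⇒Near {x = x} {y} (≤b , -≤b) b<ε =
    ≤-<-trans ≤b b<ε , ≤-<-trans (≤-resp-≈ (⁻¹-anti-homo‿- x y) refl -≤b) b<ε

  -- On the ball of radius r, f is the derivative of F with a remainder that is
  -- uniformly quadratic in the increment.
  Derivative : Carrier → (F f : Carrier → Carrier) → Set (c ⊔ ℓ₂)
  Derivative r F f = ∃[ M ] 0# ≤ M × (∀ {t v w} → Bound t r → Bound v r → Bound (v - t) w →
    Bound (F v - F t - f t * (v - t)) (M * (w * w)))

  Derivative-resp-≈ : ∀ {r F F′ f f′} → (∀ x → F x ≈ F′ x) → (∀ x → f x ≈ f′ x) →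
    Derivative r F f → Derivative r F′ f′
  Derivative-resp-≈ F≈F′ f≈f′ (M , 0≤M , h) = M , 0≤M , λ {t} {v} ht hv hw →
    Bound-resp-≈ (+-cong (+-cong (F≈F′ v) (-‿cong (F≈F′ t))) (-‿cong (*-congʳ (f≈f′ t)))) refl (h ht hv hw)

  Derivative-scale : ∀ {r F f} d → Derivative r F f → Derivative r (λ x → d * F x) (λ x → d * f x)
  Derivative-scale {r} {F} {f} d (M , 0≤M , h) with bounded d
  ... | b , d≤b = b * M , 0≤-* (Bound⇒0≤ d≤b) 0≤M , λ {t} {v} {w} ht hv hw → Bound-resp-≈
    (solve 5 (λ d Fv Ft ft e → d :* (Fv :- Ft :- ft :* e) := d :* Fv :- d :* Ft :- d :* ft :* e)
      refl d (F v) (F t) (f t) (v - t))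
    (sym (*-assoc b M (w * w)))
    (Bound-* d≤b (h ht hv hw))

  Derivative-sum : ∀ {r n} {F f : Fin n → Carrier → Carrier} → (∀ i → Derivative r (F i) (f i)) →
    Derivative r (λ x → ∑[ i < n ] F i x) (λ x → ∑[ i < n ] f i x)
  Derivative-sum {n = zero}  h = 0# , ≤-refl , λ {t} {v} {w} _ _ _ → Bound-resp-≈
    (solve 1 (λ e → 0′ := 0′ :- 0′ :- 0′ :* e) refl (v - t)) (sym (zeroˡ (w * w))) Bound-0
  Derivative-sum {n = suc n} {F} {f} h with h zero | Derivative-sum (h ∘ suc)
  ... | M , 0≤M , h₀ | M′ , 0≤M′ , hₛ = M + M′ , 0≤-+ 0≤M 0≤M′ , λ {t} {v} {w} ht hv hw → Bound-resp-≈
    (solve 7 (λ a b d a′ b′ d′ e → a :- b :- d :* e :+ (a′ :- b′ :- d′ :* e)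
      := a :+ a′ :- (b :+ b′) :- (d :+ d′) :* e) refl
      (F zero v) (F zero t) (f zero t) (∑[ i < n ] F (suc i) v) (∑[ i < n ] F (suc i) t) (∑[ i < n ] f (suc i) t) (v - t))
    (sym (distribʳ (w * w) M M′)) (Bound-+ (h₀ ht hv hw) (hₛ ht hv hw))

  Lipschitz : Carrier → (Carrier → Carrier) → Set (c ⊔ ℓ₂)
  Lipschitz r f = ∃[ K ] 0# ≤ K × (∀ {t v w} → Bound t r → Bound v r → Bound (v - t) w →
    Bound (f v - f t) (K * w))

  -- Product rule for differences: vⁿ⁺¹ - tⁿ⁺¹ = v(vⁿ - tⁿ) + (v - t)tⁿ. It supplies the second
  -- factor v - t in the quadratic remainder of the next power.
  ^-lipschitz : ∀ {r} → 0# ≤ r → ∀ n → Lipschitz r (_^ n)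
  ^-lipschitz 0≤r zero = 0# , ≤-refl , λ {_} {_} {w} _ _ _ →
    Bound-resp-≈ (sym (-‿inverseʳ 1#)) (sym (zeroˡ w)) Bound-0
  ^-lipschitz {r} 0≤r (suc n) with ^-lipschitz 0≤r n
  ... | K , 0≤K , h = r * K + r ^ n , 0≤-+ (0≤-* 0≤r 0≤K) (Bound⇒0≤ (Bound-^ n (0≤⇒Bound 0≤r ≤-refl))) ,
    λ {t} {v} {w} ht hv hw → Bound-resp-≈
      (solve 4 (λ t v tⁿ vⁿ → v :* (vⁿ :- tⁿ) :+ (v :- t) :* tⁿ := v :* vⁿ :- t :* tⁿ) refl t v (t ^ n) (v ^ n))
      (solve 4 (λ r K w rⁿ → r :* (K :* w) :+ w :* rⁿ := (r :* K :+ rⁿ) :* w) refl r K w (r ^ n))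
      (Bound-+ (Bound-* hv (h ht hv hw)) (Bound-* hw (Bound-^ n ht)))

  -- Writing Rₙ for the remainder of the n-th power, Rₙ₊₁ = t Rₙ + (v - t)(vⁿ - tⁿ); the last
  -- product is quadratic in v - t by the Lipschitz bound.
  Derivative-^ : ∀ {r} → 0# ≤ r → ∀ n → Derivative r (_^ suc n) (λ t → (suc n · 1#) * t ^ n)
  Derivative-^ {r} 0≤r zero = 0# , ≤-refl , λ {t} {v} {w} _ _ _ →
    Bound-resp-≈ (sym (linear t v)) (sym (zeroˡ (w * w))) Bound-0
    where
    linear : ∀ t v → v ^ 1 - t ^ 1 - (1 · 1#) * t ^ 0 * (v - t) ≈ 0#
    linear t v = begin
      v * 1# - t * 1# - (1# + 0#) * 1# * (v - t)  ≈⟨ +-cong (+-cong (*-identityʳ v) (-‿cong (*-identityʳ t)))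
                                                        (-‿cong (*-congʳ (trans (*-identityʳ _) (+-identityʳ 1#)))) ⟩
      v - t - 1# * (v - t)                        ≈⟨ +-congˡ (-‿cong (*-identityˡ (v - t))) ⟩
      v - t - (v - t)                             ≈⟨ -‿inverseʳ (v - t) ⟩
      0#                                          ∎
  Derivative-^ {r} 0≤r (suc n) = let M , 0≤M , h = Derivative-^ 0≤r n; K , 0≤K , lip = ^-lipschitz 0≤r (suc n) in
    r * M + K , 0≤-+ (0≤-* 0≤r 0≤M) 0≤K , λ {t} {v} {w} ht hv hw → Bound-resp-≈
    (step t v (t ^ n) (v ^ n) (suc n · 1#))
    (solve 4 (λ r M K w → r :* (M :* (w :* w)) :+ w :* (K :* w) := (r :* M :+ K) :* (w :* w)) refl r M K w)
    (Bound-+ (Bound-* ht (h ht hv hw)) (Bound-* hw (lip ht hv hw)))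
    where
    step : ∀ t v tⁿ vⁿ m →
      t * (v * vⁿ - t * tⁿ - m * tⁿ * (v - t)) + (v - t) * (v * vⁿ - t * tⁿ) ≈
      v * (v * vⁿ) - t * (t * tⁿ) - (1# + m) * (t * tⁿ) * (v - t)
    step t v tⁿ vⁿ m = begin
      t * (v * vⁿ - t * tⁿ - m * tⁿ * (v - t)) + (v - t) * (v * vⁿ - t * tⁿ)
        ≈⟨ solve 5 (λ t v a b d → t :* (a :- b :- d :* (v :- t)) :+ (v :- t) :* (a :- b)
             := v :* a :- t :* b :- (b :+ t :* d) :* (v :- t)) refl t v (v * vⁿ) (t * tⁿ) (m * tⁿ) ⟩
      v * (v * vⁿ) - t * (t * tⁿ) - (t * tⁿ + t * (m * tⁿ)) * (v - t)
        ≈⟨ +-congˡ (-‿cong (*-congʳ (+-cong (*-identityˡ (t * tⁿ))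
             (solve 3 (λ t m tⁿ → m :* (t :* tⁿ) := t :* (m :* tⁿ)) refl t m tⁿ)))) ⟨
      v * (v * vⁿ) - t * (t * tⁿ) - (1# * (t * tⁿ) + m * (t * tⁿ)) * (v - t)
        ≈⟨ +-congˡ (-‿cong (*-congʳ (distribʳ (t * tⁿ) 1# m))) ⟨
      v * (v * vⁿ) - t * (t * tⁿ) - (1# + m) * (t * tⁿ) * (v - t) ∎

  -- The fundamental theorem for Riemann sums

  Bound-between : ∀ {u t v r} → u ≤ t → t ≤ v → Bound u r → Bound v r → Bound t r
  Bound-between u≤t t≤v (_ , -u≤r) (v≤r , _) = ≤-trans t≤v v≤r , ≤-trans (neg-antitone u≤t) -u≤r

  IncrementBound : Carrier → (F f : Carrier → Carrier) → Carrier → Set (c ⊔ ℓ₂)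
  IncrementBound r F f M = ∀ {u t v} → Bound u r → Bound v r → u ≤ t → t ≤ v →
    Bound (f t * (v - u) - (F v - F u)) (M * ((v - u) * (v - u)))

  -- Expand F around the tag t at both endpoints and subtract. Since t lies between u and v, both
  -- increments are bounded by v - u, and the two remainders account for `M + M`.
  increment-bound : ∀ {r F f} → Derivative r F f → ∃[ M ] 0# ≤ M × IncrementBound r F f M
  increment-bound {r} {F} {f} (M , 0≤M , h) = M + M , 0≤-+ 0≤M 0≤M , λ {u} {t} {v} hu hv u≤t t≤v →
    let ht = Bound-between u≤t t≤v hu hv in
    Bound-resp-≈
      (solve 7 (λ Fu Ft Fv d u t v → Fu :- Ft :- d :* (u :- t) :- (Fv :- Ft :- d :* (v :- t))
        := d :* (v :- u) :- (Fv :- Fu))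
        refl (F u) (F t) (F v) (f t) u t v)
      (sym (distribʳ _ M M))
      (Bound-+ (h ht hu (Bound-sym (0≤⇒Bound (≤⇒0≤ u≤t) (+-monoˡ-≤ (- u) t≤v))))
        (Bound-neg (h ht hv (0≤⇒Bound (≤⇒0≤ t≤v) (+-mono-≤ ≤-refl (neg-antitone u≤t))))))

  ascending : ∀ n (p : Fin (suc n) → Carrier) → (∀ i → p (inject₁ i) ≤ p (suc i)) → p zero ≤ p (fromℕ n)
  ascending zero    p p↑ = ≤-refl
  ascending (suc n) p p↑ = ≤-trans (p↑ zero) (ascending n (p ∘ suc) (p↑ ∘ suc))

  -- In each squared width one factor is replaced by δ and the other is kept, so that the errors add
  -- up to a multiple of the total length. Points and tags are bare functions here because the
  -- induction drops the first cell.
  riemannSum-bound : ∀ {r F f M} → 0# ≤ M → IncrementBound r F f M →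
    ∀ δ n (p : Fin (suc n) → Carrier) (tag : Fin n → Carrier) →
    (∀ i → p (inject₁ i) ≤ tag i) → (∀ i → tag i ≤ p (suc i)) → (∀ i → p (suc i) - p (inject₁ i) < δ) →
    Bound (p zero) r → Bound (p (fromℕ n)) r →
    Bound (∑[ i < n ] (f (tag i) * (p (suc i) - p (inject₁ i))) - (F (p (fromℕ n)) - F (p zero)))
          (M * δ * (p (fromℕ n) - p zero))
  riemannSum-bound {r} {F} {f} {M} 0≤M h δ zero p tag ≤tag tag≤ fine h₀ hₙ = Bound-resp-≈
    (solve 1 (λ Fp → 0′ := 0′ :- (Fp :- Fp)) refl (F (p zero)))
    (solve 3 (λ M δ x → 0′ := M :* δ :* (x :- x)) refl M δ (p zero))
    Bound-0
  riemannSum-bound {r} {F} {f} {M} 0≤M h δ (suc n) p tag ≤tag tag≤ fine h₀ hₙ = Bound-resp-≈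
    (solve 5 (λ s S Fₙ F₁ F₀ → s :- (F₁ :- F₀) :+ (S :- (Fₙ :- F₁)) := s :+ S :- (Fₙ :- F₀)) refl
      (f (tag zero) * (p (suc zero) - p zero)) (∑[ i < n ] (f (tag (suc i)) * (p (suc (suc i)) - p (suc (inject₁ i)))))
      (F (p (fromℕ (suc n)))) (F (p (suc zero))) (F (p zero)))
    (solve 5 (λ M δ pₙ p₁ p₀ → M :* δ :* (p₁ :- p₀) :+ M :* δ :* (pₙ :- p₁) := M :* δ :* (pₙ :- p₀)) refl
      M δ (p (fromℕ (suc n))) (p (suc zero)) (p zero))
    (Bound-+
      (Bound-weaken (≤-resp-≈ refl (sym (*-assoc M δ _)) (*-monoˡ-≤ 0≤M
          (≤-resp-≈ refl (*-comm _ δ) (*-monoˡ-≤ (≤⇒0≤ p₀≤p₁) (<⇒≤ (fine zero))))))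
        (h h₀ h₁ (≤tag zero) (tag≤ zero)))
      (riemannSum-bound {r} {F} {f} 0≤M h δ n (p ∘ suc) (tag ∘ suc) (≤tag ∘ suc) (tag≤ ∘ suc) (fine ∘ suc) h₁ hₙ))
    where
    p₀≤p₁ : p zero ≤ p (suc zero)
    p₀≤p₁ = ≤-trans (≤tag zero) (tag≤ zero)
    -- The shortened partition starts at an inner point; it lies in the ball because it lies between
    -- the endpoints.
    h₁ : Bound (p (suc zero)) r
    h₁ = Bound-between p₀≤p₁ (ascending n (p ∘ suc) (λ i → ≤-trans (≤tag (suc i)) (tag≤ (suc i)))) h₀ hₙ

  fundamental-theorem : ∀ {r F f a b} → (∀ {x y} → x ≈ y → F x ≈ F y) → Derivative r F f →
    a ≤ b → Bound a r → Bound b r → IsRiemannIntegral a b f (F b - F a)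
  fundamental-theorem {r} {F} {f} {a} {b} F-cong D a≤b ha hb ε 0<ε =
    let M , 0≤M , h = increment-bound D
        -- The summand 1 makes K invertible even when M(b - a) vanishes. With δ = ε/K it also gives
        -- Mδ(b - a) = ε - δ, strictly below ε.
        K = M * (b - a) + 1#
        0<K = <.<-respˡ-≈ (+-identityʳ 0#) (≤-<-trans (+-monoˡ-≤ 0# (0≤-* 0≤M (≤⇒0≤ a≤b)))
                (<-resp-≈ (+-comm 0# _) (+-comm 1# _) (+-monoˡ-< (M * (b - a)) 0<1)))
        K⁻¹ , 0<K⁻¹ , KK⁻¹≈1 = inverse-pos 0<K
        δ = ε * K⁻¹
        0<δ = *-pos 0<ε 0<K⁻¹
        slack : δ + M * δ * (b - a) ≈ ε
        slack = begin
          ε * K⁻¹ + M * (ε * K⁻¹) * (b - a)         ≈⟨ +-congʳ (*-identityʳ δ) ⟨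
          ε * K⁻¹ * 1# + M * (ε * K⁻¹) * (b - a)    ≈⟨ solve 5 (λ ε K⁻¹ M w o → ε :* K⁻¹ :* o :+ M :* (ε :* K⁻¹) :* w
                                                         := ε :* ((M :* w :+ o) :* K⁻¹)) refl ε K⁻¹ M (b - a) 1# ⟩
          ε * (K * K⁻¹)                             ≈⟨ *-congˡ KK⁻¹≈1 ⟩
          ε * 1#                                    ≈⟨ *-identityʳ ε ⟩
          ε                                         ∎
    in δ , 0<δ , λ P fine → let open TaggedPartition P using (size; point; tag; end; point≤tag; tag≤point)
                                                 renaming (start to start≈a) in
      Bound⇒Near
        (Bound-resp-≈ (+-congˡ (-‿cong (+-cong (F-cong end) (-‿cong (F-cong start≈a)))))
          (*-congˡ (+-cong end (-‿cong start≈a)))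
          (riemannSum-bound {r} {F} {f} 0≤M h δ size point tag point≤tag tag≤point fine
            (Bound-resp-≈ (sym start≈a) refl ha) (Bound-resp-≈ (sym end) refl hb)))
        (<-resp-≈ (+-identityˡ _) slack (+-monoˡ-< (M * δ * (b - a)) 0<δ))

  IsRiemannIntegral-resp-≈ : ∀ {a b f I J} → I ≈ J → IsRiemannIntegral a b f I → IsRiemannIntegral a b f J
  IsRiemannIntegral-resp-≈ I≈J h ε 0<ε = let δ , 0<δ , near = h ε 0<ε in δ , 0<δ , λ P fine →
    let <ε , <ε′ = near P fine in <.<-respˡ-≈ (+-congˡ (-‿cong I≈J)) <ε , <.<-respˡ-≈ (+-congʳ I≈J) <ε′

  -- Apartness of `l` from 0 yields its sign. For negative `l` the theorem is applied on the
  -- interval from `l` to 0, where F 0 - F l is the negated value that `IsIntegral` demands.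
  integral-from-0 : ∀ {F f l I} → (∀ {x y} → x ≈ y → F x ≈ F y) → (∀ {r} → 0# ≤ r → Derivative r F f) →
    l # 0# → F l - F 0# ≈ I → IsIntegral 0# l f I
  integral-from-0 {F} {f} {l} F-cong D l#0 Fl-F0≈I with Equivalence.to #⇔<⊎> l#0
  ... | inj₂ 0<l = inj₁ (<⇒≤ 0<l , IsRiemannIntegral-resp-≈ {f = f} Fl-F0≈I
    (fundamental-theorem {F = F} F-cong (D (<⇒≤ 0<l)) (<⇒≤ 0<l)
      (0≤⇒Bound ≤-refl (<⇒≤ 0<l)) (0≤⇒Bound (<⇒≤ 0<l) ≤-refl)))
  ... | inj₁ l<0 = inj₂ (<⇒≤ l<0 , IsRiemannIntegral-resp-≈ {f = f}
    (trans (sym (⁻¹-anti-homo‿- (F l) (F 0#))) (-‿cong Fl-F0≈I))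
    (fundamental-theorem {F = F} F-cong (D 0≤-l) (<⇒≤ l<0)
      (Bound-resp-≈ (⁻¹-involutive l) refl (Bound-neg (0≤⇒Bound 0≤-l ≤-refl)))
      (0≤⇒Bound ≤-refl 0≤-l)))
    where
    0≤-l : 0# ≤ - l
    0≤-l = neg-nonneg (<⇒≤ l<0)

  -- Iterated integrals of polynomials in t₁⋯tₖ

  -- Nested formal sums without a normal form: the double sums obtained from binomial expansions are
  -- represented as they stand, and like powers need not be collected.
  data Polynomial : Set c where
    monomial : Carrier → ℕ → Polynomial
    sumₚ     : ∀ {n} → (Fin n → Polynomial) → Polynomial

  -- The linear functional sending the j-th power of the variable to φ j.
  ⟦_⟧ : Polynomial → (ℕ → Carrier) → Carrier
  ⟦ monomial d j ⟧ φ = d * φ j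
  ⟦ sumₚ {n} ps  ⟧ φ = ∑[ i < n ] (⟦ ps i ⟧ φ)

  -- Serves two purposes: the weights t ʲ fix one variable of the product at t, and the moments of
  -- the remaining variables integrate those out.
  weight : (ℕ → Carrier) → Polynomial → Polynomial
  weight w (monomial d j) = monomial (d * w j) j
  weight w (sumₚ ps)      = sumₚ (λ i → weight w (ps i))

  ⟦⟧-cong : ∀ p {φ ψ} → (∀ j → φ j ≈ ψ j) → ⟦ p ⟧ φ ≈ ⟦ p ⟧ ψ
  ⟦⟧-cong (monomial d j) φ≈ψ = *-congˡ (φ≈ψ j)
  ⟦⟧-cong (sumₚ ps)      φ≈ψ = sum-cong-≋ (λ i → ⟦⟧-cong (ps i) φ≈ψ)

  ⟦⟧-zero : ∀ p {φ} → (∀ j → φ j ≈ 0#) → ⟦ p ⟧ φ ≈ 0#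
  ⟦⟧-zero (monomial d j) φ≈0 = trans (*-congˡ (φ≈0 j)) (zeroʳ d)
  ⟦⟧-zero (sumₚ {n} ps)  φ≈0 = trans (sum-cong-≋ (λ i → ⟦⟧-zero (ps i) φ≈0)) (sum-replicate-zero n)

  ⟦weight⟧ : ∀ w p φ → ⟦ weight w p ⟧ φ ≈ ⟦ p ⟧ (λ j → w j * φ j)
  ⟦weight⟧ w (monomial d j) φ = *-assoc d (w j) (φ j)
  ⟦weight⟧ w (sumₚ ps)      φ = sum-cong-≋ (λ i → ⟦weight⟧ w (ps i) φ)

  1/-inverseˡ : ∀ n .{{_ : NonZero n}} → (1/ n) * (n · 1#) ≈ 1#
  1/-inverseˡ (suc n) = trans (*-congˡ (sym (x-0≈x (suc n · 1#)))) (proj₁ (proj₂ (#⇒invertible (suc#0 n))))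

  1/-unique : ∀ n .{{_ : NonZero n}} {x} → x * (n · 1#) ≈ 1# → 1/ n ≈ x
  1/-unique n {x} x*n≈1 = begin
    1/ n                     ≈⟨ *-identityʳ (1/ n) ⟨
    1/ n * 1#                ≈⟨ *-congˡ x*n≈1 ⟨
    1/ n * (x * (n · 1#))    ≈⟨ solve 3 (λ a x n → a :* (x :* n) := x :* (a :* n)) refl (1/ n) x (n · 1#) ⟩
    x * (1/ n * (n · 1#))    ≈⟨ *-congˡ (1/-inverseˡ n) ⟩
    x * 1#                   ≈⟨ *-identityʳ x ⟩
    x                        ∎

  -- Iterated integration yields powers of reciprocals, while `augmented` has reciprocals of powers;
  -- both invert the same number.
  1/-^ : ∀ n .{{_ : NonZero n}} k .{{_ : NonZero (n ℕ.^ k)}} → 1/ (n ℕ.^ k) ≈ (1/ n) ^ k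
  1/-^ n k = 1/-unique (n ℕ.^ k) (inverse k)
    where
    inverse : ∀ k → (1/ n) ^ k * ((n ℕ.^ k) · 1#) ≈ 1#
    inverse zero    = trans (*-identityˡ _) (+-identityʳ 1#)
    inverse (suc k) = begin
      1/ n * (1/ n) ^ k * ((n ℕ.* n ℕ.^ k) · 1#)             ≈⟨ *-congˡ (×1-homo-* n (n ℕ.^ k)) ⟩
      1/ n * (1/ n) ^ k * ((n · 1#) * ((n ℕ.^ k) · 1#))      ≈⟨ solve 4 (λ a b x y → a :* b :* (x :* y) := (a :* x) :* (b :* y))
                                                                  refl (1/ n) ((1/ n) ^ k) (n · 1#) ((n ℕ.^ k) · 1#) ⟩
      1/ n * (n · 1#) * ((1/ n) ^ k * ((n ℕ.^ k) · 1#))      ≈⟨ *-cong (1/-inverseˡ n) (inverse k) ⟩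
      1# * 1#                                                ≈⟨ *-identityˡ 1# ⟩
      1#                                                     ∎

  Derivative-polynomial : ∀ p {r} → 0# ≤ r → Derivative r (λ t → ⟦ p ⟧ (λ j → 1/ (suc j) * t ^ suc j)) (λ t → ⟦ p ⟧ (t ^_))
  Derivative-polynomial (monomial d j) 0≤r = Derivative-scale d
    (Derivative-resp-≈ (λ _ → refl) power (Derivative-scale (1/ (suc j)) (Derivative-^ 0≤r j)))
    where
    power : ∀ t → 1/ (suc j) * ((suc j · 1#) * t ^ j) ≈ t ^ j
    power t = begin
      1/ (suc j) * ((suc j · 1#) * t ^ j)    ≈⟨ *-assoc (1/ (suc j)) (suc j · 1#) (t ^ j) ⟨
      1/ (suc j) * (suc j · 1#) * t ^ j      ≈⟨ *-congʳ (1/-inverseˡ (suc j)) ⟩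
      1# * t ^ j                             ≈⟨ *-identityˡ (t ^ j) ⟩
      t ^ j                                  ∎
  Derivative-polynomial (sumₚ ps) 0≤r = Derivative-sum (λ i → Derivative-polynomial (ps i) 0≤r)

  1^n≈1 : ∀ n → 1# ^ n ≈ 1#
  1^n≈1 zero    = refl
  1^n≈1 (suc n) = trans (*-identityˡ _) (1^n≈1 n)

  -- Induction on k with `p` arbitrary, since fixing the outermost variable changes the
  -- coefficients. Allowing `F` and `I` up to `≈` lets the induction hypothesis apply without
  -- rewriting them.
  iterated-integral : ∀ {k} (L : Vector Carrier k) p {F I} → (∀ i → L i # 0#) →
    (∀ ts → F ts ≈ ⟦ p ⟧ (product ts ^_)) →
    I ≈ ⟦ p ⟧ (λ j → (1/ (suc j)) ^ k * product L ^ suc j) →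
    IsIteratedIntegral L F I
  iterated-integral {zero} L p {F} {I} L#0 F≈ I≈ = lift (begin
    I                                   ≈⟨ I≈ ⟩
    ⟦ p ⟧ (λ j → 1# * (1# * 1# ^ j))    ≈⟨ ⟦⟧-cong p (λ j → trans (*-identityˡ _) (*-identityˡ _)) ⟩
    ⟦ p ⟧ (λ j → 1# ^ j)                ≈⟨ F≈ [] ⟨
    F []                                ∎)
  iterated-integral {suc k} L p {F} {I} L#0 F≈ I≈ = g , inner , outer
    where
    l P : Carrier
    l = head L
    P = product (tail L)
    ρ : ℕ → Carrier
    ρ j = 1/ (suc j)
    -- `w j` is the iterated integral of (t₂⋯tₖ₊₁)ʲ over the variables other than the outermost.
    w : ℕ → Carrier
    w j = ρ j ^ k * P ^ suc j
    q : Polynomial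
    q = weight w p
    g : Carrier → Carrier
    g t = ⟦ q ⟧ (t ^_)

    inner : ∀ t → Between 0# l t → IsIteratedIntegral (tail L) (λ ts → F (t ∷ ts)) (g t)
    inner t _ = iterated-integral (tail L) (weight (t ^_) p) (L#0 ∘ suc)
      (λ ts → begin
        F (t ∷ ts)                                 ≈⟨ F≈ (t ∷ ts) ⟩
        ⟦ p ⟧ (λ j → (t * product ts) ^ j)         ≈⟨ ⟦⟧-cong p (^-distrib-* t (product ts)) ⟩
        ⟦ p ⟧ (λ j → t ^ j * product ts ^ j)       ≈⟨ ⟦weight⟧ (t ^_) p _ ⟨
        ⟦ weight (t ^_) p ⟧ (product ts ^_)        ∎)
      (begin
        -- Weights and evaluation trade places: t is a constant for the inner integral and the
        -- variable of the outer one.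
        ⟦ weight w p ⟧ (t ^_)            ≈⟨ ⟦weight⟧ w p (t ^_) ⟩
        ⟦ p ⟧ (λ j → w j * t ^ j)        ≈⟨ ⟦⟧-cong p (λ j → *-comm (w j) (t ^ j)) ⟩
        ⟦ p ⟧ (λ j → t ^ j * w j)        ≈⟨ ⟦weight⟧ (t ^_) p w ⟨
        ⟦ weight (t ^_) p ⟧ w            ∎)

    antiderivative : Carrier → Carrier
    antiderivative t = ⟦ q ⟧ (λ j → ρ j * t ^ suc j)

    antiderivative-cong : ∀ {x y} → x ≈ y → antiderivative x ≈ antiderivative y
    antiderivative-cong x≈y = ⟦⟧-cong q (λ j → *-congˡ (^-congˡ (suc j) x≈y))

    outer : IsIntegral 0# l g I
    outer = integral-from-0 {antiderivative} antiderivative-cong (Derivative-polynomial q) (L#0 zero) (begin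
      -- Every exponent is a successor, so the antiderivative vanishes at 0.
      antiderivative l - antiderivative 0#         ≈⟨ +-congˡ (-‿cong (⟦⟧-zero q λ j →
                                                        trans (*-congˡ (zeroˡ _)) (zeroʳ (ρ j)))) ⟩
      antiderivative l - 0#                        ≈⟨ x-0≈x (antiderivative l) ⟩
      ⟦ weight w p ⟧ (λ j → ρ j * l ^ suc j)       ≈⟨ ⟦weight⟧ w p _ ⟩
      ⟦ p ⟧ (λ j → w j * (ρ j * l ^ suc j))        ≈⟨ ⟦⟧-cong p reorder ⟩
      ⟦ p ⟧ (λ j → ρ j ^ suc k * (l * P) ^ suc j)  ≈⟨ I≈ ⟨
      I                                            ∎)
      where
      reorder : ∀ j → w j * (ρ j * l ^ suc j) ≈ ρ j ^ suc k * (l * P) ^ suc j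
      reorder j = begin
        ρ j ^ k * P ^ suc j * (ρ j * l ^ suc j)    ≈⟨ solve 4 (λ a b d e → a :* b :* (d :* e) := d :* a :* (e :* b))
                                                        refl (ρ j ^ k) (P ^ suc j) (ρ j) (l ^ suc j) ⟩
        ρ j * ρ j ^ k * (l ^ suc j * P ^ suc j)    ≈⟨ *-congˡ (^-distrib-* l P (suc j)) ⟨
        ρ j * ρ j ^ k * (l * P) ^ suc j            ∎

  -- Generating function of the Stirling polynomials

  -- Under the Stirling recurrence the part s(p) contributes the factor z and the part n s(p + 1)
  -- the factor nq, together the new factor z + nq.
  risingFactorial : ∀ n z q →
    ∑[ p ≤ n ] (stirling₁ n (toℕ p) · (q ^ (n ∸ toℕ p) * z ^ toℕ p)) ≈ product {n} (λ j → z + toℕ j · q)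
  risingFactorial zero    z q = trans (+-identityʳ _) (trans (+-identityʳ _) (*-identityˡ 1#))
  risingFactorial (suc n) z q = begin
    -- The leading zero is the term p = 0, where `stirling₁ (suc n) 0` vanishes.
    0# + ∑[ p ≤ n ] ((n ℕ.* s (suc (toℕ p)) ℕ.+ s (toℕ p)) · (q ^ (n ∸ toℕ p) * z ^ suc (toℕ p)))
      ≈⟨ +-identityˡ _ ⟩
    ∑[ p ≤ n ] ((n ℕ.* s (suc (toℕ p)) ℕ.+ s (toℕ p)) · (q ^ (n ∸ toℕ p) * z ^ suc (toℕ p)))
      ≈⟨ sum-cong-≋ split ⟩
    ∑[ p ≤ n ] ((n · 1#) * term (suc n) (suc (toℕ p)) + z * term n (toℕ p))
      ≈⟨ ∑-distrib-+ {suc n} (λ p → (n · 1#) * term (suc n) (suc (toℕ p))) (λ p → z * term n (toℕ p)) ⟩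
    ∑[ p ≤ n ] ((n · 1#) * term (suc n) (suc (toℕ p))) + ∑[ p ≤ n ] (z * term n (toℕ p))
      ≈⟨ +-cong (*-distribˡ-sum {suc n} (n · 1#) (λ p → term (suc n) (suc (toℕ p))))
           (*-distribˡ-sum {suc n} z (λ p → term n (toℕ p))) ⟨
    (n · 1#) * ∑[ p ≤ n ] term (suc n) (suc (toℕ p)) + z * ∑[ p ≤ n ] term n (toℕ p)
      ≈⟨ +-congʳ (begin
           (n · 1#) * ∑[ p ≤ n ] term (suc n) (suc (toℕ p))
             ≈⟨ +-identityˡ _ ⟨
           0# + (n · 1#) * ∑[ p ≤ n ] term (suc n) (suc (toℕ p))
             -- Reinstates the term p = 0: it vanishes through the factor n if n = 0, and through
             -- the Stirling number otherwise.
             ≈⟨ +-congʳ (ns[n,0]≈0 n) ⟨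
           (n · 1#) * term (suc n) 0 + (n · 1#) * ∑[ p ≤ n ] term (suc n) (suc (toℕ p))
             ≈⟨ distribˡ _ _ _ ⟨
           (n · 1#) * ∑[ p ≤ suc n ] term (suc n) (toℕ p)
             ≈⟨ *-congˡ shift ⟩
           (n · 1#) * (q * ∑[ p ≤ n ] term n (toℕ p)) ∎) ⟩
    (n · 1#) * (q * ∑[ p ≤ n ] term n (toℕ p)) + z * ∑[ p ≤ n ] term n (toℕ p)
      ≈⟨ solve 4 (λ N q z A → N :* (q :* A) :+ z :* A := A :* (z :+ N :* q)) refl (n · 1#) q z (∑[ p ≤ n ] term n (toℕ p)) ⟩
    (∑[ p ≤ n ] term n (toℕ p)) * (z + (n · 1#) * q)
      ≈⟨ *-cong (risingFactorial n z q) (+-congˡ (trans (×-assoc-* n 1# q) (×-congʳ n (*-identityˡ q)))) ⟩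
    product {n} (λ j → z + toℕ j · q) * (z + n · q)
      ≡⟨ ≡.cong (λ k → product {n} (λ j → z + toℕ j · q) * (z + k · q)) (Fin.toℕ-fromℕ n) ⟨
    product {n} (λ j → z + toℕ j · q) * (z + toℕ (fromℕ n) · q)
      ≈⟨ *-congʳ (product-cong {n} λ j → reflexive (≡.cong (λ k → z + k · q) (Fin.toℕ-inject₁ j))) ⟨
    product {n} (λ j → z + toℕ (inject₁ j) · q) * (z + toℕ (fromℕ n) · q)
      ≈⟨ product-init-last {n} (λ j → z + toℕ j · q) ⟨
    product {suc n} (λ j → z + toℕ j · q) ∎
    where
    s : ℕ → ℕ
    s = stirling₁ n

    term : ℕ → ℕ → Carrier
    term N p = s p · (q ^ (N ∸ p) * z ^ p)

    split : ∀ (p : Fin (suc n)) → (n ℕ.* s (suc (toℕ p)) ℕ.+ s (toℕ p)) · (q ^ (n ∸ toℕ p) * z ^ suc (toℕ p)) ≈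
      (n · 1#) * term (suc n) (suc (toℕ p)) + z * term n (toℕ p)
    split i = begin
      (n ℕ.* s (suc p) ℕ.+ s p) · X
        ≈⟨ ×-homo-+ X (n ℕ.* s (suc p)) (s p) ⟩
      (n ℕ.* s (suc p)) · X + s p · X
        ≈⟨ +-cong (×-assocˡ X n (s (suc p))) (×-congʳ (s p)
             (solve 3 (λ a z b → z :* (a :* b) := a :* (z :* b)) refl (q ^ (n ∸ p)) z (z ^ p))) ⟨
      n · (s (suc p) · X) + s p · (z * (q ^ (n ∸ p) * z ^ p))
        ≈⟨ +-cong (trans (×-assoc-* n 1# _) (×-congʳ n (*-identityˡ _))) (×-comm-* (s p) z _) ⟨
      (n · 1#) * (s (suc p) · X) + z * (s p · (q ^ (n ∸ p) * z ^ p)) ∎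
      where
      p = toℕ i
      X = q ^ (n ∸ p) * z ^ suc p

    ns[n,0]≈0 : ∀ n → (n · 1#) * (stirling₁ n 0 · (q ^ suc n * 1#)) ≈ 0#
    ns[n,0]≈0 zero    = zeroˡ _
    ns[n,0]≈0 (suc n) = zeroʳ _

    -- The top term contains `stirling₁ n (suc n)`, which is 0. In all others p ≤ n, so the
    -- truncated exponent really is one larger and a factor q splits off.
    shift : ∑[ p ≤ suc n ] term (suc n) (toℕ p) ≈ q * ∑[ p ≤ n ] term n (toℕ p)
    shift = begin
      ∑[ p ≤ suc n ] term (suc n) (toℕ p)
        ≈⟨ sum-init-last {suc n} (λ p → term (suc n) (toℕ p)) ⟩
      ∑[ p ≤ n ] term (suc n) (toℕ (inject₁ p)) + term (suc n) (toℕ (fromℕ (suc n)))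
        ≡⟨ ≡.cong (λ k → ∑[ p ≤ n ] term (suc n) (toℕ (inject₁ p)) +
               k · (q ^ (suc n ∸ toℕ (fromℕ (suc n))) * z ^ toℕ (fromℕ (suc n))))
             (≡.trans (≡.cong s (Fin.toℕ-fromℕ (suc n))) (stirling₁-zero (ℕ.n<1+n n))) ⟩
      ∑[ p ≤ n ] term (suc n) (toℕ (inject₁ p)) + 0#
        ≈⟨ +-identityʳ _ ⟩
      ∑[ p ≤ n ] term (suc n) (toℕ (inject₁ p))
        ≈⟨ sum-cong-≋ extract ⟩
      ∑[ p ≤ n ] (q * term n (toℕ p))
        ≈⟨ *-distribˡ-sum {suc n} q (λ p → term n (toℕ p)) ⟨
      q * ∑[ p ≤ n ] term n (toℕ p) ∎
      where
      extract : ∀ (i : Fin (suc n)) → term (suc n) (toℕ (inject₁ i)) ≈ q * term n (toℕ i)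
      extract i rewrite Fin.toℕ-inject₁ i | ℕ.+-∸-assoc 1 (ℕ.≤-pred (Fin.toℕ<n i)) =
        trans (×-congʳ (s (toℕ i)) (*-assoc q _ _)) (sym (×-comm-* (s (toℕ i)) q _))

  -- Reindexing by p = i + m. Removing m = 0 leaves a triangle one size smaller, with both arguments
  -- of `f` shifted by one.
  ∑-triangle : ∀ n (f : ℕ → ℕ → Carrier) →
    ∑[ m ≤ n ] ∑[ i ≤ n ∸ toℕ m ] f (toℕ m) (toℕ i ℕ.+ toℕ m) ≈ ∑[ p ≤ n ] ∑[ m ≤ toℕ p ] f (toℕ m) (toℕ p)
  ∑-triangle zero    f = refl
  ∑-triangle (suc n) f = begin
    ∑[ i ≤ suc n ] f 0 (toℕ i ℕ.+ 0) + ∑[ m ≤ n ] ∑[ i ≤ n ∸ toℕ m ] f (suc (toℕ m)) (toℕ i ℕ.+ suc (toℕ m))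
      ≈⟨ +-cong (sum-cong-≋ {suc (suc n)} λ i → reflexive (≡.cong (f 0) (ℕ.+-identityʳ (toℕ i))))
           (sum-cong-≋ {suc n} λ m → sum-cong-≋ {suc (n ∸ toℕ m)} λ i →
             reflexive (≡.cong (f (suc (toℕ m))) (ℕ.+-suc (toℕ i) (toℕ m)))) ⟩
    ∑[ p ≤ suc n ] f 0 (toℕ p) + ∑[ m ≤ n ] ∑[ i ≤ n ∸ toℕ m ] f (suc (toℕ m)) (suc (toℕ i ℕ.+ toℕ m))
      ≈⟨ +-congˡ (∑-triangle n (λ m p → f (suc m) (suc p))) ⟩
    ∑[ p ≤ suc n ] f 0 (toℕ p) + ∑[ p ≤ n ] ∑[ m ≤ toℕ p ] f (suc (toℕ m)) (suc (toℕ p))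
      -- Supplies p = 0, whose inner sum over m < 0 is empty.
      ≈⟨ +-congˡ (+-identityˡ _) ⟨
    ∑[ p ≤ suc n ] f 0 (toℕ p) + ∑[ p ≤ suc n ] ∑[ m < toℕ p ] f (suc (toℕ m)) (toℕ p)
      ≈⟨ ∑-distrib-+ {suc (suc n)} (λ p → f 0 (toℕ p)) (λ p → ∑[ m < toℕ p ] f (suc (toℕ m)) (toℕ p)) ⟨
    ∑[ p ≤ suc n ] ∑[ m ≤ toℕ p ] f (toℕ m) (toℕ p) ∎

  stirlingPoly-generating : ∀ n y q u →
    ∑[ m ≤ n ] (stirlingPoly n (toℕ m) y q * u ^ toℕ m) ≈ product {n} (λ j → u + y + toℕ j · q)
  stirlingPoly-generating n y q u = begin
    ∑[ m ≤ n ] (stirlingPoly n (toℕ m) y q * u ^ toℕ m)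
      ≈⟨ sum-cong-≋ {suc n} (λ m → trans (*-distribʳ-sum {suc (n ∸ toℕ m)} (u ^ toℕ m) (λ i →
             (((toℕ i ℕ.+ toℕ m) C toℕ m) ℕ.* stirling₁ n (toℕ i ℕ.+ toℕ m)) · (y ^ toℕ i * q ^ (n ∸ toℕ m ∸ toℕ i))))
           (sum-cong-≋ {suc (n ∸ toℕ m)} (λ i → reindex (toℕ m) (toℕ i)))) ⟩
    ∑[ m ≤ n ] ∑[ i ≤ n ∸ toℕ m ] f (toℕ m) (toℕ i ℕ.+ toℕ m)
      ≈⟨ ∑-triangle n f ⟩
    ∑[ p ≤ n ] ∑[ m ≤ toℕ p ] f (toℕ m) (toℕ p)
      ≈⟨ sum-cong-≋ {suc n} (λ p → collect (toℕ p)) ⟩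
    ∑[ p ≤ n ] (stirling₁ n (toℕ p) · (q ^ (n ∸ toℕ p) * (u + y) ^ toℕ p))
      ≈⟨ risingFactorial n (u + y) q ⟩
    product {n} (λ j → u + y + toℕ j · q) ∎
    where
    -- The summand in terms of p = i + m: for fixed p its dependence on m is that of a binomial
    -- expansion of (u + y)ᵖ.
    f : ℕ → ℕ → Carrier
    f m p = ((p C m) ℕ.* stirling₁ n p) · (y ^ (p ∸ m) * q ^ (n ∸ p)) * u ^ m

    reindex : ∀ m i → (((i ℕ.+ m) C m) ℕ.* stirling₁ n (i ℕ.+ m)) · (y ^ i * q ^ (n ∸ m ∸ i)) * u ^ m ≈ f m (i ℕ.+ m)
    reindex m i = reflexive (≡.cong₂ (λ d e → (((i ℕ.+ m) C m) ℕ.* stirling₁ n (i ℕ.+ m)) · (y ^ d * q ^ e) * u ^ m)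
      (≡.sym (ℕ.m+n∸n≡m i m)) (≡.trans (ℕ.∸-+-assoc n m i) (≡.cong (n ∸_) (ℕ.+-comm m i))))

    collect : ∀ p → ∑[ m ≤ p ] f (toℕ m) p ≈ stirling₁ n p · (q ^ (n ∸ p) * (u + y) ^ p)
    collect p = begin
      ∑[ m ≤ p ] f (toℕ m) p
        ≈⟨ sum-cong-≋ {suc p} (λ m → factor (toℕ m)) ⟩
      ∑[ m ≤ p ] ((stirling₁ n p · 1#) * q ^ (n ∸ p) * ((p C toℕ m) · (u ^ toℕ m * y ^ (p ∸ toℕ m))))
        ≈⟨ *-distribˡ-sum {suc p} _ (λ m → (p C toℕ m) · (u ^ toℕ m * y ^ (p ∸ toℕ m))) ⟨
      (stirling₁ n p · 1#) * q ^ (n ∸ p) * ∑[ m ≤ p ] ((p C toℕ m) · (u ^ toℕ m * y ^ (p ∸ toℕ m)))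
        ≈⟨ *-congˡ (Binomial.theorem commutativeSemiring p u y) ⟨
      (stirling₁ n p · 1#) * q ^ (n ∸ p) * (u + y) ^ p
        ≈⟨ *-assoc _ _ _ ⟩
      (stirling₁ n p · 1#) * (q ^ (n ∸ p) * (u + y) ^ p)
        ≈⟨ trans (×-assoc-* (stirling₁ n p) 1# _) (×-congʳ (stirling₁ n p) (*-identityˡ _)) ⟩
      stirling₁ n p · (q ^ (n ∸ p) * (u + y) ^ p) ∎
      where
      factor : ∀ m → f m p ≈ (stirling₁ n p · 1#) * q ^ (n ∸ p) * ((p C m) · (u ^ m * y ^ (p ∸ m)))
      factor m = begin
        ((p C m) ℕ.* stirling₁ n p) · (y ^ (p ∸ m) * q ^ (n ∸ p)) * u ^ m
          ≈⟨ *-congʳ (·≈* ((p C m) ℕ.* stirling₁ n p) _) ⟩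
        (((p C m) ℕ.* stirling₁ n p) · 1#) * (y ^ (p ∸ m) * q ^ (n ∸ p)) * u ^ m
          ≈⟨ *-congʳ (*-congʳ (×1-homo-* (p C m) (stirling₁ n p))) ⟩
        ((p C m) · 1#) * (stirling₁ n p · 1#) * (y ^ (p ∸ m) * q ^ (n ∸ p)) * u ^ m
          ≈⟨ solve 5 (λ b s y q u → b :* s :* (y :* q) :* u := s :* q :* (b :* (u :* y))) refl
               ((p C m) · 1#) (stirling₁ n p · 1#) (y ^ (p ∸ m)) (q ^ (n ∸ p)) (u ^ m) ⟩
        (stirling₁ n p · 1#) * q ^ (n ∸ p) * (((p C m) · 1#) * (u ^ m * y ^ (p ∸ m)))
          ≈⟨ *-congˡ (·≈* (p C m) _) ⟨
        (stirling₁ n p · 1#) * q ^ (n ∸ p) * ((p C m) · (u ^ m * y ^ (p ∸ m))) ∎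
        where
        ·≈* : ∀ n x → n · x ≈ (n · 1#) * x
        ·≈* n x = sym (trans (×-assoc-* n 1# x) (×-congʳ n (*-identityˡ x)))

  -- Expansion of the integrands in powers of x - t₁⋯tₖ

  neg-^ : ∀ x n → (- x) ^ n ≈ (- 1#) ^ n * x ^ n
  neg-^ x n = trans (^-congˡ n (sym (-1*x≈-x x))) (^-distrib-* (- 1#) x n)

  [-1]^n-involutive : ∀ n → (- 1#) ^ n * (- 1#) ^ n ≈ 1#
  [-1]^n-involutive n = begin
    (- 1#) ^ n * (- 1#) ^ n    ≈⟨ ^-distrib-* (- 1#) (- 1#) n ⟨
    (- 1# * - 1#) ^ n          ≈⟨ ^-congˡ n (trans (-1*x≈-x (- 1#)) (⁻¹-involutive 1#)) ⟩
    1# ^ n                     ≈⟨ 1^n≈1 n ⟩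
    1#                         ∎

  product-scale : ∀ {n} d (f : Fin n → Carrier) → product {n} (λ j → d * f j) ≈ d ^ n * product f
  product-scale {zero}  d f = sym (*-identityˡ 1#)
  product-scale {suc n} d f = begin
    d * f zero * product {n} (λ j → d * f (suc j))    ≈⟨ *-congˡ (product-scale d (f ∘ suc)) ⟩
    d * f zero * (d ^ n * product (f ∘ suc))          ≈⟨ solve 4 (λ d a e b → d :* a :* (e :* b) := d :* e :* (a :* b))
                                                           refl d (f zero) (d ^ n) (product (f ∘ suc)) ⟩
    d * d ^ n * (f zero * product (f ∘ suc))          ∎

  -- The separate clause at j = 0 agrees with the general sum, so all exponents can be treated
  -- alike.
  augmented-formula : ∀ {k} j x (L : Vector Carrier k) →
    ∑[ i ≤ j ] ((- 1#) ^ toℕ i * (1/ (suc (toℕ i) ℕ.^ k)) {{ℕ.m^n≢0 (suc (toℕ i)) k}} *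
                product L ^ suc (toℕ i) * ((j C toℕ i) · x ^ (j ∸ toℕ i))) ≈ augmented j x L
  augmented-formula {k} zero x L = begin
    1# * (1/ (1 ℕ.^ k)) {{ℕ.m^n≢0 1 k}} * (product L * 1#) * (1# + 0#) + 0#    ≈⟨ +-identityʳ _ ⟩
    1# * (1/ (1 ℕ.^ k)) {{ℕ.m^n≢0 1 k}} * (product L * 1#) * (1# + 0#)
      ≈⟨ *-cong (*-cong (trans (*-identityˡ _) (1/-unique (1 ℕ.^ k) {{ℕ.m^n≢0 1 k}} 1/1^k≈1)) (*-identityʳ _))
           (+-identityʳ 1#) ⟩
    1# * product L * 1#                                                        ≈⟨ *-identityʳ _ ⟩
    1# * product L                                                             ≈⟨ *-identityˡ _ ⟩
    product L                                                                  ∎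
    where
    1/1^k≈1 : 1# * ((1 ℕ.^ k) · 1#) ≈ 1#
    1/1^k≈1 = begin
      1# * ((1 ℕ.^ k) · 1#)    ≈⟨ *-identityˡ _ ⟩
      (1 ℕ.^ k) · 1#           ≡⟨ ≡.cong (_· 1#) (ℕ.^-zeroˡ k) ⟩
      1# + 0#                  ≈⟨ +-identityʳ 1# ⟩
      1#                       ∎
  augmented-formula (suc j) x L = refl

  -- Coefficients and exponents are arbitrary so that both kinds are instances, differing only in
  -- their signs.
  iterated-integral-[x-t]^ : ∀ {k} (L : Vector Carrier k) → (∀ i → L i # 0#) →
    ∀ x {n} (β : Fin n → Carrier) (J : Fin n → ℕ) {F I} →
    (∀ ts → F ts ≈ ∑[ m < n ] (β m * (x - product ts) ^ J m)) →
    I ≈ ∑[ m < n ] (β m * augmented (J m) x L) →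
    IsIteratedIntegral L F I
  iterated-integral-[x-t]^ {k} L L#0 x {n} β J {F} {I} F≈ I≈ = iterated-integral L p L#0
    (λ ts → begin
      F ts                                                         ≈⟨ F≈ ts ⟩
      ∑[ m < n ] (β m * (x - product ts) ^ J m)                    ≈⟨ sum-cong-≋ {n} (λ m → integrand (β m) (J m) (product ts)) ⟩
      ⟦ p ⟧ (product ts ^_)                                        ∎)
    (begin
      I                                                            ≈⟨ I≈ ⟩
      ∑[ m < n ] (β m * augmented (J m) x L)                       ≈⟨ sum-cong-≋ {n} (λ m → value (β m) (J m)) ⟩
      ⟦ p ⟧ (λ i → (1/ (suc i)) ^ k * product L ^ suc i)           ∎)
    where
    coefficient : Carrier → ℕ → ℕ → Carrier
    coefficient b j i = b * ((- 1#) ^ i * ((j C i) · x ^ (j ∸ i)))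

    summand : Carrier → ℕ → Polynomial
    summand b j = sumₚ {suc j} (λ i → monomial (coefficient b j (toℕ i)) (toℕ i))

    p : Polynomial
    p = sumₚ (λ m → summand (β m) (J m))

    integrand : ∀ b j T → b * (x - T) ^ j ≈ ⟦ summand b j ⟧ (T ^_)
    integrand b j T = begin
      b * (x - T) ^ j
        -- The binomial theorem gives the summation index to the first summand, and here it must be
        -- the exponent of T.
        ≈⟨ *-congˡ (^-congˡ j (+-comm x (- T))) ⟩
      b * (- T + x) ^ j
        ≈⟨ *-congˡ (Binomial.theorem commutativeSemiring j (- T) x) ⟩
      b * ∑[ i ≤ j ] ((j C toℕ i) · ((- T) ^ toℕ i * x ^ (j ∸ toℕ i)))
        ≈⟨ *-distribˡ-sum {suc j} b (λ i → (j C toℕ i) · ((- T) ^ toℕ i * x ^ (j ∸ toℕ i))) ⟩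
      ∑[ i ≤ j ] (b * ((j C toℕ i) · ((- T) ^ toℕ i * x ^ (j ∸ toℕ i))))
        ≈⟨ sum-cong-≋ {suc j} (λ i → term (toℕ i)) ⟩
      ∑[ i ≤ j ] (coefficient b j (toℕ i) * T ^ toℕ i) ∎
      where
      term : ∀ i → b * ((j C i) · ((- T) ^ i * x ^ (j ∸ i))) ≈ coefficient b j i * T ^ i
      term i = begin
        b * ((j C i) · ((- T) ^ i * x ^ (j ∸ i)))
          ≈⟨ *-congˡ (×-comm-* (j C i) ((- T) ^ i) (x ^ (j ∸ i))) ⟨
        b * ((- T) ^ i * ((j C i) · x ^ (j ∸ i)))
          ≈⟨ *-congˡ (*-congʳ (neg-^ T i)) ⟩
        b * ((- 1#) ^ i * T ^ i * ((j C i) · x ^ (j ∸ i)))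
          ≈⟨ solve 4 (λ b s t e → b :* (s :* t :* e) := b :* (s :* e) :* t) refl
               b ((- 1#) ^ i) (T ^ i) ((j C i) · x ^ (j ∸ i)) ⟩
        b * ((- 1#) ^ i * ((j C i) · x ^ (j ∸ i))) * T ^ i ∎

    value : ∀ b j → b * augmented j x L ≈ ⟦ summand b j ⟧ (λ i → (1/ (suc i)) ^ k * product L ^ suc i)
    value b j = begin
      b * augmented j x L
        ≈⟨ *-congˡ (augmented-formula j x L) ⟨
      b * ∑[ i ≤ j ] ((- 1#) ^ toℕ i * (1/ (suc (toℕ i) ℕ.^ k)) {{ℕ.m^n≢0 (suc (toℕ i)) k}} *
                      product L ^ suc (toℕ i) * ((j C toℕ i) · x ^ (j ∸ toℕ i)))
        ≈⟨ *-distribˡ-sum {suc j} b (λ i → (- 1#) ^ toℕ i * (1/ (suc (toℕ i) ℕ.^ k)) {{ℕ.m^n≢0 (suc (toℕ i)) k}} *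
                      product L ^ suc (toℕ i) * ((j C toℕ i) · x ^ (j ∸ toℕ i))) ⟩
      ∑[ i ≤ j ] (b * ((- 1#) ^ toℕ i * (1/ (suc (toℕ i) ℕ.^ k)) {{ℕ.m^n≢0 (suc (toℕ i)) k}} *
                      product L ^ suc (toℕ i) * ((j C toℕ i) · x ^ (j ∸ toℕ i))))
        ≈⟨ sum-cong-≋ {suc j} (λ i → term (toℕ i)) ⟩
      ∑[ i ≤ j ] (coefficient b j (toℕ i) * ((1/ (suc (toℕ i))) ^ k * product L ^ suc (toℕ i))) ∎
      where
      term : ∀ i → b * ((- 1#) ^ i * (1/ (suc i ℕ.^ k)) {{ℕ.m^n≢0 (suc i) k}} * product L ^ suc i *
                      ((j C i) · x ^ (j ∸ i))) ≈
        coefficient b j i * ((1/ (suc i)) ^ k * product L ^ suc i)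
      term i = begin
        b * ((- 1#) ^ i * (1/ (suc i ℕ.^ k)) {{ℕ.m^n≢0 (suc i) k}} * product L ^ suc i * ((j C i) · x ^ (j ∸ i)))
          ≈⟨ *-congˡ (*-congʳ (*-congʳ (*-congˡ (1/-^ (suc i) k {{ℕ.m^n≢0 (suc i) k}})))) ⟩
        b * ((- 1#) ^ i * (1/ (suc i)) ^ k * product L ^ suc i * ((j C i) · x ^ (j ∸ i)))
          ≈⟨ solve 5 (λ b s r P e → b :* (s :* r :* P :* e) := b :* (s :* e) :* (r :* P)) refl
               b ((- 1#) ^ i) ((1/ (suc i)) ^ k) (product L ^ suc i) ((j C i) · x ^ (j ∸ i)) ⟩
        b * ((- 1#) ^ i * ((j C i) · x ^ (j ∸ i))) * ((1/ (suc i)) ^ k * product L ^ suc i) ∎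

  -- The explicit formulas for the two kinds

  ^-shift : ∀ u a m → u ^ (m ℕ.+ suc a ∸ 1) ≈ u ^ a * u ^ m
  ^-shift u a m = begin
    -- Addition recurses on `m`, so the predecessor does not reduce until `suc` is moved to the
    -- front.
    u ^ (m ℕ.+ suc a ∸ 1)    ≡⟨ ≡.cong (λ e → u ^ (e ∸ 1)) (ℕ.+-suc m a) ⟩
    u ^ (m ℕ.+ a)            ≈⟨ ^-homo-* u m a ⟩
    u ^ m * u ^ a            ≈⟨ *-comm _ _ ⟩
    u ^ a * u ^ m            ∎

  -- With u = x - T, the power of T - x = -u gives the sign (-1)ᵃ, and the n factors T - x - y - jq
  -- = -(u + y + jq) give (-1)ⁿ. Here `a` is one less than the parameter of the polynomial.
  polyCauchy₁ : ∀ {k} n a q (L : Vector Carrier k) x y → (∀ i → L i # 0#) →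
    IsPolyCauchy₁ n (suc a) q L y x
      ((- 1#) ^ a * (∑[ m ≤ n ] ((- 1#) ^ n * stirlingPoly n (toℕ m) y q *
        augmented (toℕ m ℕ.+ suc a ∸ 1) x L)))
  polyCauchy₁ n a q L x y L#0 = iterated-integral-[x-t]^ L L#0 x {suc n}
    (λ m → (- 1#) ^ a * ((- 1#) ^ n * S (toℕ m))) (λ m → toℕ m ℕ.+ suc a ∸ 1)
    (λ ts → integrand (product ts))
    (trans (*-distribˡ-sum {suc n} ((- 1#) ^ a) (λ m → (- 1#) ^ n * S (toℕ m) * augmented (toℕ m ℕ.+ suc a ∸ 1) x L))
      (sum-cong-≋ {suc n} (λ m →
        sym (*-assoc ((- 1#) ^ a) ((- 1#) ^ n * S (toℕ m)) (augmented (toℕ m ℕ.+ suc a ∸ 1) x L)))))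
    where
    S : ℕ → Carrier
    S m = stirlingPoly n m y q

    integrand : ∀ T → (T - x) ^ a * product {n} (λ j → T - x - y - toℕ j · q) ≈
      ∑[ m ≤ n ] ((- 1#) ^ a * ((- 1#) ^ n * S (toℕ m)) * (x - T) ^ (toℕ m ℕ.+ suc a ∸ 1))
    integrand T = begin
      (T - x) ^ a * product {n} (λ j → T - x - y - toℕ j · q)
        ≈⟨ *-cong (trans (^-congˡ a (sym (⁻¹-anti-homo‿- x T))) (neg-^ u a))
             (product-cong {n} λ j → trans
               (solve 4 (λ T x y e → T :- x :- y :- e := :- (x :- T :+ y :+ e)) refl T x y (toℕ j · q))
               (sym (-1*x≈-x _))) ⟩
      (- 1#) ^ a * u ^ a * product {n} (λ j → - 1# * (u + y + toℕ j · q))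
        ≈⟨ *-congˡ (product-scale {n} (- 1#) (λ j → u + y + toℕ j · q)) ⟩
      (- 1#) ^ a * u ^ a * ((- 1#) ^ n * product {n} (λ j → u + y + toℕ j · q))
        ≈⟨ *-congˡ (*-congˡ (stirlingPoly-generating n y q u)) ⟨
      (- 1#) ^ a * u ^ a * ((- 1#) ^ n * ∑[ m ≤ n ] (S (toℕ m) * u ^ toℕ m))
        ≈⟨ *-assoc _ _ _ ⟨
      (- 1#) ^ a * u ^ a * (- 1#) ^ n * ∑[ m ≤ n ] (S (toℕ m) * u ^ toℕ m)
        ≈⟨ *-distribˡ-sum {suc n} _ (λ m → S (toℕ m) * u ^ toℕ m) ⟩
      ∑[ m ≤ n ] ((- 1#) ^ a * u ^ a * (- 1#) ^ n * (S (toℕ m) * u ^ toℕ m))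
        ≈⟨ sum-cong-≋ {suc n} (λ m → term (toℕ m)) ⟩
      ∑[ m ≤ n ] ((- 1#) ^ a * ((- 1#) ^ n * S (toℕ m)) * u ^ (toℕ m ℕ.+ suc a ∸ 1)) ∎
      where
      u : Carrier
      u = x - T

      term : ∀ m → (- 1#) ^ a * u ^ a * (- 1#) ^ n * (S m * u ^ m) ≈
        (- 1#) ^ a * ((- 1#) ^ n * S m) * u ^ (m ℕ.+ suc a ∸ 1)
      term m = begin
        (- 1#) ^ a * u ^ a * (- 1#) ^ n * (S m * u ^ m)
          ≈⟨ solve 5 (λ e v f s w → e :* v :* f :* (s :* w) := e :* (f :* s) :* (v :* w)) refl
               ((- 1#) ^ a) (u ^ a) ((- 1#) ^ n) (S m) (u ^ m) ⟩
        (- 1#) ^ a * ((- 1#) ^ n * S m) * (u ^ a * u ^ m)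
          ≈⟨ *-congˡ (^-shift u a m) ⟨
        (- 1#) ^ a * ((- 1#) ^ n * S m) * u ^ (m ℕ.+ suc a ∸ 1) ∎

  -- Here x + y - T - jq = -(-u - y + jq), so the generating function is taken at -u with parameter
  -- -y. The sign (-1)ᵐ from (-u)ᵐ combines with (-1)ⁿ; the outer sign belongs to the definition of
  -- the second kind.
  polyCauchy₂ : ∀ {k} n a q (L : Vector Carrier k) x y → (∀ i → L i # 0#) →
    IsPolyCauchy₂ n (suc a) q L y x
      ((- 1#) ^ a * (∑[ m ≤ n ] ((- 1#) ^ (n ∸ toℕ m) * stirlingPoly n (toℕ m) (- y) q *
        augmented (toℕ m ℕ.+ suc a ∸ 1) x L)))
  polyCauchy₂ n a q L x y L#0 = _ ,
    iterated-integral-[x-t]^ L L#0 x {suc n} (λ m → (- 1#) ^ (n ∸ toℕ m) * S (toℕ m)) (λ m → toℕ m ℕ.+ suc a ∸ 1)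
      (λ ts → integrand (product ts)) refl ,
    refl
    where
    S : ℕ → Carrier
    S m = stirlingPoly n m (- y) q

    integrand : ∀ T → (x - T) ^ a * product {n} (λ j → x + y - T - toℕ j · q) ≈
      ∑[ m ≤ n ] ((- 1#) ^ (n ∸ toℕ m) * S (toℕ m) * (x - T) ^ (toℕ m ℕ.+ suc a ∸ 1))
    integrand T = begin
      u ^ a * product {n} (λ j → x + y - T - toℕ j · q)
        ≈⟨ *-congˡ (product-cong {n} λ j → trans
             (solve 4 (λ T x y e → x :+ y :- T :- e := :- (:- (x :- T) :- y :+ e)) refl T x y (toℕ j · q))
               (sym (-1*x≈-x _))) ⟩
      u ^ a * product {n} (λ j → - 1# * (- u - y + toℕ j · q))
        ≈⟨ *-congˡ (product-scale {n} (- 1#) (λ j → - u - y + toℕ j · q)) ⟩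
      u ^ a * ((- 1#) ^ n * product {n} (λ j → - u - y + toℕ j · q))
        ≈⟨ *-congˡ (*-congˡ (stirlingPoly-generating n (- y) q (- u))) ⟨
      u ^ a * ((- 1#) ^ n * ∑[ m ≤ n ] (S (toℕ m) * (- u) ^ toℕ m))
        ≈⟨ *-assoc _ _ _ ⟨
      u ^ a * (- 1#) ^ n * ∑[ m ≤ n ] (S (toℕ m) * (- u) ^ toℕ m)
        ≈⟨ *-distribˡ-sum {suc n} _ (λ m → S (toℕ m) * (- u) ^ toℕ m) ⟩
      ∑[ m ≤ n ] (u ^ a * (- 1#) ^ n * (S (toℕ m) * (- u) ^ toℕ m))
        ≈⟨ sum-cong-≋ {suc n} (λ m → term (toℕ m) (ℕ.≤-pred (Fin.toℕ<n m))) ⟩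
      ∑[ m ≤ n ] ((- 1#) ^ (n ∸ toℕ m) * S (toℕ m) * u ^ (toℕ m ℕ.+ suc a ∸ 1)) ∎
      where
      u : Carrier
      u = x - T

      -- Split n as (n - m) + m, which requires m ≤ n; the two copies of (-1)ᵐ then cancel.
      [-1]^-∸ : ∀ m → m ℕ.≤ n → (- 1#) ^ n * (- 1#) ^ m ≈ (- 1#) ^ (n ∸ m)
      [-1]^-∸ m m≤n = begin
        (- 1#) ^ n * (- 1#) ^ m                          ≡⟨ ≡.cong (λ e → (- 1#) ^ e * (- 1#) ^ m) (ℕ.m∸n+n≡m m≤n) ⟨
        (- 1#) ^ (n ∸ m ℕ.+ m) * (- 1#) ^ m              ≈⟨ *-congʳ (^-homo-* (- 1#) (n ∸ m) m) ⟩
        (- 1#) ^ (n ∸ m) * (- 1#) ^ m * (- 1#) ^ m       ≈⟨ *-assoc _ _ _ ⟩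
        (- 1#) ^ (n ∸ m) * ((- 1#) ^ m * (- 1#) ^ m)     ≈⟨ *-congˡ ([-1]^n-involutive m) ⟩
        (- 1#) ^ (n ∸ m) * 1#                            ≈⟨ *-identityʳ _ ⟩
        (- 1#) ^ (n ∸ m)                                 ∎

      term : ∀ m → m ℕ.≤ n → u ^ a * (- 1#) ^ n * (S m * (- u) ^ m) ≈
        (- 1#) ^ (n ∸ m) * S m * u ^ (m ℕ.+ suc a ∸ 1)
      term m m≤n = begin
        u ^ a * (- 1#) ^ n * (S m * (- u) ^ m)
          ≈⟨ *-congˡ (*-congˡ (neg-^ u m)) ⟩
        u ^ a * (- 1#) ^ n * (S m * ((- 1#) ^ m * u ^ m))
          ≈⟨ solve 5 (λ v e s f w → v :* e :* (s :* (f :* w)) := e :* f :* s :* (v :* w)) refl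
               (u ^ a) ((- 1#) ^ n) (S m) ((- 1#) ^ m) (u ^ m) ⟩
        (- 1#) ^ n * (- 1#) ^ m * S m * (u ^ a * u ^ m)
          ≈⟨ *-cong (*-congʳ ([-1]^-∸ m m≤n)) (sym (^-shift u a m)) ⟩
        (- 1#) ^ (n ∸ m) * S m * u ^ (m ℕ.+ suc a ∸ 1) ∎

theorem12 :
    ∀ {c ℓ₁ ℓ₂} (ℝ : RealField c ℓ₁ ℓ₂) →
    let open RealField ℝ
        open PolyCauchy ℝ
    in
    ∀ (n k a : ℕ) → 1 ℕ.≤ k → 1 ℕ.≤ a →
    ∀ (q : Carrier) (L : Vector Carrier k) (x y : Carrier) →
    (∀ i → L i # 0#) →
    IsPolyCauchy₁ n a q L y x
      ((- 1#) ^ (a ∸ 1) *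
        (∑[ m ≤ n ] ((- 1#) ^ n * stirlingPoly n (toℕ m) y q * augmented (toℕ m ℕ.+ a ∸ 1) x L)))
    ×
    IsPolyCauchy₂ n a q L y x
      ((- 1#) ^ (a ∸ 1) *
        (∑[ m ≤ n ] ((- 1#) ^ (n ∸ toℕ m) * stirlingPoly n (toℕ m) (- y) q * augmented (toℕ m ℕ.+ a ∸ 1) x L)))
-- With the parameter a successor, the truncated `a ∸ 1` reduces to the shifted index of both
-- formulas; zero is excluded by `1 ℕ.≤ a`.
theorem12 ℝ n k (suc a) _ _ q L x y L#0 = polyCauchy₁ n a q L x y L#0 , polyCauchy₂ n a q L x y L#0
  where open PolyCauchyExpansion ℝ
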